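{- Let $n\ge 16$ be even and let $W_{4,n}$ be the $4$-regular Kn\"odel graph. Then $W_{4,n}$ is $\gamma$-stable if and only if (i) $n\in\{18,28\}$, or (ii) $n\equiv 0\pmod{10}$ or $n\equiv 4\pmod{10}$, or (iii) $n\ne 26$ and $n\equiv 6\pmod{10}$.
   Context: For an even integer $n\ge 2$ and $1\le\Delta\le\lfloor\log_2 n\rfloor$, the Kn\"odel graph $W_{\Delta,n}$ is the $\Delta$-regular bipartite graph on the $n$ vertices $(i,j)$, $i\in\{1,2\}$, $0\le j\le n/2-1$, in which for every $j$ the vertex $(1,j)$ is adjacent to the vertices $(2,(j+2^k-1)\bmod (n/2))$ for $k=0,1,\dots,\Delta-1$ (and there are no other edges). A set $D$ of vertices of a graph $G$ is dominating if every vertex not in $D$ is adjacent to a vertex of $D$; $\gamma(G)$ is the minimum size of a dominating set. A graph $G$ is $\gamma$-stable if $\gamma(G-u)=\gamma(G)$ for every vertex $u$ of $G$, where $G-u$ is the graph obtained by deleting $u$. -}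

module Defs where

open import Data.Empty using (⊥; ⊥-elim)
open import Data.Fin using (Fin; zero; suc; toℕ; punchIn; remQuot)
open import Data.Fin.Properties using (all?; any?; nonZeroIndex)
open import Data.Fin.Subset using (Subset; _∈_; _∉_; ∣_∣; ⊤)
open import Data.Fin.Subset.Properties using (_∈?_; anySubset?; ∈⊤; ∣⊤∣≡n)
open import Data.Nat using (ℕ; zero; suc; pred; _+_; _*_; _∸_; _^_; _/_; _%_; _≤_; z≤n; s≤s)
import Data.Nat as ℕ
open import Data.Product using (_×_; _,_; proj₁; proj₂; ∃)
open import Relation.Binary using (Rel; Decidable; Symmetric; Irreflexive)
open import Relation.Binary.PropositionalEquality using (_≡_; refl)
open import Relation.Nullary using (¬_; Dec; yes; no; ¬?; _×-dec_; _→-dec_)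
import Relation.Unary as U
open import Level using (0ℓ)

-- A simple graph on the vertex set Fin n.
record Graph (n : ℕ) : Set₁ where
  field
    Adj    : Rel (Fin n) 0ℓ
    adj?   : Decidable Adj
    sym    : Symmetric Adj
    irrefl : Irreflexive _≡_ Adj

-- Vertex deletion; punchIn u enumerates the vertices other than u.
delete : ∀ {n} → Graph n → Fin n → Graph (pred n)
delete {suc n} G u = record
  { Adj    = λ v w → Adj (punchIn u v) (punchIn u w)
  ; adj?   = λ v w → adj? (punchIn u v) (punchIn u w)
  ; sym    = sym
  ; irrefl = λ { refl → irrefl refl }
  }
  where open Graph G

Dominating : ∀ {n} → Graph n → Subset n → Set
Dominating G D = ∀ v → v ∉ D → ∃ λ w → w ∈ D × Graph.Adj G v w

dominating? : ∀ {n} (G : Graph n) → U.Decidable (Dominating G)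
dominating? G D = all? λ v →
  ¬? (v ∈? D) →-dec any? λ w → (w ∈? D) ×-dec Graph.adj? G v w

HasDominatingSetOfSize : ∀ {n} → Graph n → ℕ → Set
HasDominatingSetOfSize G k = ∃ λ D → Dominating G D × ∣ D ∣ ≡ k

hasDominatingSetOfSize? : ∀ {n} (G : Graph n) → U.Decidable (HasDominatingSetOfSize G)
hasDominatingSetOfSize? G k = anySubset? λ D → dominating? G D ×-dec (∣ D ∣ ℕ.≟ k)

IsLeast : (ℕ → Set) → ℕ → Set
IsLeast P k = P k × (∀ {j} → P j → k ≤ j)

least : ∀ {P : ℕ → Set} → U.Decidable P → ∀ k → P k → ∃ (IsLeast P)
least P? zero pk = zero , pk , λ _ → z≤n
least {P} P? (suc k) pk with P? zero
... | yes p0 = zero , p0 , λ _ → z≤n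
... | no ¬p0 with least (λ j → P? (suc j)) k pk
...   | m , pm , lower = suc m , pm , bound
  where
  bound : ∀ {j} → P j → suc m ≤ j
  bound {zero}  p0 = ⊥-elim (¬p0 p0)
  bound {suc j} pj = s≤s (lower pj)

-- The search succeeds because the full vertex set is dominating.
minimumDominatingSize : ∀ {n} (G : Graph n) → ∃ (IsLeast (HasDominatingSetOfSize G))
minimumDominatingSize {n} G =
  least (hasDominatingSetOfSize? G) n (⊤ , (λ v v∉⊤ → ⊥-elim (v∉⊤ ∈⊤)) , ∣⊤∣≡n n)

γ : ∀ {n} → Graph n → ℕ
γ G = proj₁ (minimumDominatingSize G)

γ-isLeast : ∀ {n} (G : Graph n) → IsLeast (HasDominatingSetOfSize G) (γ G)
γ-isLeast G = proj₂ (minimumDominatingSize G)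

γ-Stable : ∀ {n} → Graph n → Set
γ-Stable G = ∀ u → γ (delete G u) ≡ γ G

-- The sides i = 1 and i = 2 of the bipartition are 0 and 1 in Fin 2.
-- Subtracting 1 from the power first is harmless, since 2 ^ k ≥ 1.
KnödelAdj : ∀ Δ {m} → Rel (Fin 2 × Fin m) 0ℓ
KnödelAdj Δ {m} (zero , j) (suc zero , j′) =
  ∃ λ (k : Fin Δ) → toℕ j′ ≡ _%_ (toℕ j + (2 ^ toℕ k ∸ 1)) m {{nonZeroIndex j}}
KnödelAdj Δ (suc zero , j′) (zero , j) = KnödelAdj Δ (zero , j) (suc zero , j′)
KnödelAdj Δ (zero     , _) (zero     , _) = ⊥
KnödelAdj Δ (suc zero , _) (suc zero , _) = ⊥

knödelAdj? : ∀ Δ {m} → Decidable (KnödelAdj Δ {m})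
knödelAdj? Δ (zero , j) (suc zero , j′) = any? λ k → toℕ j′ ℕ.≟ _
knödelAdj? Δ (suc zero , j′) (zero , j) = any? λ k → toℕ j′ ℕ.≟ _
knödelAdj? Δ (zero     , _) (zero     , _) = no λ ()
knödelAdj? Δ (suc zero , _) (suc zero , _) = no λ ()

knödel-sym : ∀ Δ {m} → Symmetric (KnödelAdj Δ {m})
knödel-sym Δ {_} {zero     , _} {suc zero , _} e = e
knödel-sym Δ {_} {suc zero , _} {zero     , _} e = e
knödel-sym Δ {_} {zero     , _} {zero     , _} ()
knödel-sym Δ {_} {suc zero , _} {suc zero , _} ()

knödel-irrefl : ∀ Δ {m} (p : Fin 2 × Fin m) → ¬ KnödelAdj Δ p p
knödel-irrefl Δ (zero     , _) ()
knödel-irrefl Δ (suc zero , _) ()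

-- The Knödel graph W_{Δ,n}, for even n ≥ 2 and 1 ≤ Δ ≤ ⌊log₂ n⌋.
-- The vertex (i , j) is the element combine i j of Fin (2 * (n / 2)),
-- which has n elements when n is even.
W : ∀ Δ n → Graph (2 * (n / 2))
W Δ n = record
  { Adj    = λ v w → KnödelAdj Δ (pair v) (pair w)
  ; adj?   = λ v w → knödelAdj? Δ (pair v) (pair w)
  ; sym    = λ {v} {w} → knödel-sym Δ {_} {pair v} {pair w}
  ; irrefl = λ { {v} refl → knödel-irrefl Δ (pair v) }
  }
  where
  pair : Fin (2 * (n / 2)) → Fin 2 × Fin (n / 2)
  pair = remQuot {2} (n / 2)

{-# OPTIONS --safe #-}

-- Let m = n / 2.  A set of vertices is a pair of m-periodic 0-1 sequences a, b, one for each side.  Counting closed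
-- neighbourhoods on each side separately shows that a (nearly) dominating set that is too small must have one of
-- finitely many profiles, in which only a number of vertices bounded independently of m is dominated more than once.
-- Whether a vertex is dominated depends on eight consecutive places, so such sets are closed walks in an automaton
-- whose states are the last seven places and the excess spent so far.  The number of places seen is held against
-- five times the number of members in a; starting the walk as in the cycle lemma, this balance never becomes
-- negative, and then the walks of a given length reach only finitely many states, and no new ones when a large length
-- grows by 5.  A finite search therefore excludes the profiles for all large m at once.  Sets that are large enough
-- are a short word followed by copies of a block of 5 places with 2 members.  Rotations move them off any given
-- vertex, so that they also serve for the vertex-deleted graphs.

module Submission where

open import Defs
open import Data.Bool using (Bool; true; false; _∧_; _∨_; T; T?; if_then_else_; not)
import Data.Bool.Properties as Bool
open import Data.Bool.Properties using (T-∧; T-≡)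
open import Data.Empty using (⊥; ⊥-elim)
open import Data.Fin using (Fin; zero; suc; toℕ; combine; remQuot; punchIn; punchOut)
open import Data.Fin.Patterns using (0F; 1F; 2F; 3F; 4F)
import Data.Fin.Properties as Fin
open import Data.Fin.Properties using
  (toℕ-fromℕ<; toℕ-injective; toℕ<n; toℕ-combine; remQuot-combine; combine-surjective; punchInᵢ≢i; punchIn-punchOut)
open import Data.Fin.Subset using (Subset; _∈_; _∉_; ∣_∣; outside)
open import Data.List using (List; []; _∷_; _++_; concatMap; length; take)
open import Data.List.Membership.Propositional using () renaming (_∈_ to _∈ₗ_; _∉_ to _∉ₗ_)
open import Data.List.Membership.Propositional.Properties using (∈-++⁺ˡ; ∈-++⁺ʳ; ∈-concatMap⁺)
open import Data.List.Properties using (length-++; length-take)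
open import Data.List.Relation.Binary.Subset.Propositional using (_⊆_)
open import Data.List.Relation.Binary.Subset.Propositional.Properties using (concatMap⁺)
import Data.List.Relation.Unary.All as All
open import Data.List.Relation.Unary.Any using (here)
import Data.List.Relation.Unary.Any as Any
open import Data.Nat using
  (ℕ; zero; suc; pred; _+_; _*_; _∸_; _^_; _/_; _%_; _≤_; _<_; _≤ᵇ_; _<ᵇ_; z≤n; s≤s; _≤?_; _<?_; NonZero; >-nonZero)
open import Data.Nat.Divisibility using (_∣_)
open import Data.Nat.DivMod
import Data.Nat.Properties as ℕ
open import Data.Nat.Properties hiding (_≟_; _≤?_; _<?_)
open import Algebra.Properties.CommutativeSemigroup +-commutativeSemigroup using (interchange; x∙yz≈y∙xz)
open import Data.Nat.Tactic.RingSolver using (solve-∀)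
open import Data.Product using (_×_; _,_; proj₁; proj₂; ∃)
import Data.Product.Properties as Product
open import Data.Sum using (_⊎_; inj₁; inj₂)
open import Data.Unit using (tt)
open import Data.Vec using (Vec; []; _∷_; lookup; tabulate; insertAt; removeAt)
import Data.Vec.Properties as Vec
open import Data.Vec.Properties using
  ([]=⇒lookup; lookup⇒[]=; lookup∘tabulate; insertAt-punchIn; insertAt-removeAt)
open import Function using (_∘_; Equivalence)
open import Function.Bundles using (_⇔_; mk⇔)
open import Relation.Binary using (DecidableEquality)
open import Relation.Binary.PropositionalEquality
open import Relation.Nullary using (¬_; Dec; does; yes; no; contradiction)

-- Periodic sequences, their sums and coverage counts

Seq : Set
Seq = ℕ → Bool

Periodic : ∀ {A : Set} → ℕ → (ℕ → A) → Set
Periodic m f = ∀ x → f (m + x) ≡ f x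

bit : Bool → ℕ
bit false = 0
bit true = 1

∑ : (ℕ → ℕ) → ℕ → ℕ
∑ f zero    = 0
∑ f (suc n) = ∑ f n + f n

∑-cong : ∀ {f g} n → (∀ x → x < n → f x ≡ g x) → ∑ f n ≡ ∑ g n
∑-cong zero    eq = refl
∑-cong (suc n) eq = cong₂ _+_ (∑-cong n λ x x<n → eq x (m<n⇒m<1+n x<n)) (eq n ≤-refl)

∑-+ : ∀ f i n → ∑ f (n + i) ≡ ∑ f i + ∑ (λ x → f (x + i)) n
∑-+ f i zero    = sym (+-identityʳ _)
∑-+ f i (suc n) = trans (cong (_+ f (n + i)) (∑-+ f i n)) (+-assoc (∑ f i) _ _)

∑-mono : ∀ f {k n} → k ≤ n → ∑ f k ≤ ∑ f n
∑-mono f {k} {n} k≤n = subst (λ z → ∑ f k ≤ ∑ f z) (m∸n+n≡m k≤n)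
  (subst (∑ f k ≤_) (sym (∑-+ f k (n ∸ k))) (m≤m+n _ _))

-- Splitting `∑ f (m + i)` after `i` terms leaves the shifted sum; splitting it after `m` terms
-- leaves, by periodicity, `∑ f i` once more.
∑-shift : ∀ {m f} → Periodic m f → ∀ i → ∑ (λ x → f (x + i)) m ≡ ∑ f m
∑-shift {m} {f} p i = +-cancelˡ-≡ (∑ f i) _ _ (begin
  ∑ f i + ∑ (λ x → f (x + i)) m ≡⟨ ∑-+ f i m ⟨
  ∑ f (m + i)                   ≡⟨ cong (∑ f) (+-comm m i) ⟩
  ∑ f (i + m)                   ≡⟨ ∑-+ f m i ⟩
  ∑ f m + ∑ (λ x → f (x + m)) i ≡⟨ cong (∑ f m +_) (∑-cong i λ x _ → trans (cong f (+-comm x m)) (p x)) ⟩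
  ∑ f m + ∑ f i                 ≡⟨ +-comm (∑ f m) _ ⟩
  ∑ f i + ∑ f m                 ∎)
  where open ≡-Reasoning

-- cov₁ a b x counts the members of the closed neighbourhood of (1 , x), and cov₂ a b x those of the closed
-- neighbourhood of (2 , 7 + x), where the shift avoids subtractions.
cov₁ cov₂ : Seq → Seq → ℕ → ℕ
cov₁ a b x = bit (a x) + (bit (b x) + (bit (b (1 + x)) + (bit (b (3 + x)) + bit (b (7 + x)))))
cov₂ a b x = bit (a x) + (bit (a (4 + x)) + (bit (a (6 + x)) + (bit (a (7 + x)) + bit (b (7 + x)))))

excess defect : (ℕ → ℕ) → ℕ → ℕ
excess c = ∑ (λ x → pred (c x))
defect c = ∑ (λ x → 1 ∸ c x)

∣_∣[_] : Seq → ℕ → ℕ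
∣ a ∣[ m ] = ∑ (bit ∘ a) m

-- Excess and defect of the two sides; the drift 5 ∣ a ∣[ m ] - m is given as u₁ - u₀.
record Profile : Set where
  constructor profile
  field C₂ F₂ C₁ F₁ u₀ u₁ : ℕ

record HasProfile (P : Profile) (m : ℕ) (a b : Seq) : Set where
  open Profile P
  field
    periodicᵃ : Periodic m a
    periodicᵇ : Periodic m b
    excess₂   : excess (cov₂ a b) m ≡ C₂
    defect₂   : defect (cov₂ a b) m ≡ F₂
    excess₁   : excess (cov₁ a b) m ≡ C₁
    defect₁   : defect (cov₁ a b) m ≡ F₁
    drift     : u₀ + 5 * ∣ a ∣[ m ] ≡ m + u₁

-- The last seven places of either side, then the running values of C₂, F₂, C₁, F₁ and of the balance.
Config : Set
Config = Vec Bool 7 × Vec Bool 7 × Vec ℕ 5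

_≟ᶜ_ : DecidableEquality Config
_≟ᶜ_ = Product.≡-dec (Vec.≡-dec Bool._≟_) (Product.≡-dec (Vec.≡-dec Bool._≟_) (Vec.≡-dec ℕ._≟_))

open import Data.List.Membership.DecPropositional _≟ᶜ_ using (_∈?_)

-- Bit vectors and windows of a sequence

allBits : ∀ n → (Vec Bool n → Bool) → Bool
allBits zero    p = p []
allBits (suc n) p = allBits n (λ v → p (true ∷ v)) ∧ allBits n (λ v → p (false ∷ v))

allBits-sound : ∀ n {p} → T (allBits n p) → ∀ v → T (p v)
allBits-sound zero    t []          = t
allBits-sound (suc n) t (true ∷ v)  = allBits-sound n (proj₁ (Equivalence.to T-∧ t)) v
allBits-sound (suc n) {p} t (false ∷ v) =
  allBits-sound n (proj₂ (Equivalence.to (T-∧ {allBits n (λ v → p (true ∷ v))}) t)) v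

weight : ∀ {n} → Vec Bool n → ℕ
weight []       = 0
weight (x ∷ xs) = bit x + weight xs

window : ∀ n → Seq → ℕ → Vec Bool n
window zero    a x = []
window (suc n) a x = a x ∷ window n a (suc x)

window-cong : ∀ n {a x y} → (∀ i → a (i + x) ≡ a (i + y)) → window n a x ≡ window n a y
window-cong zero    eq = refl
window-cong (suc n) {a} {x} {y} eq = cong₂ _∷_ (eq 0)
  (window-cong n λ i → trans (cong a (+-suc i x)) (trans (eq (suc i)) (cong a (sym (+-suc i y)))))

∑-weight : ∀ a k x → ∣ a ∣[ x ] + weight (window k a x) ≡ ∣ a ∣[ k + x ]
∑-weight a zero    x = +-identityʳ _
∑-weight a (suc k) x = begin
  ∣ a ∣[ x ] + (bit (a x) + weight (window k a (suc x))) ≡⟨ +-assoc ∣ a ∣[ x ] _ _ ⟨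
  ∣ a ∣[ suc x ] + weight (window k a (suc x))           ≡⟨ ∑-weight a k (suc x) ⟩
  ∣ a ∣[ k + suc x ]                                     ≡⟨ cong ∣ a ∣[_] (+-suc k x) ⟩
  ∣ a ∣[ suc k + x ]                                     ∎
  where open ≡-Reasoning

-- The automaton and its finite search

module Search (P : Profile) where
  open Profile P

  step : Config → Bool → Bool → List Config
  step (a₀ ∷ a₁ ∷ a₂ ∷ a₃ ∷ a₄ ∷ a₅ ∷ a₆ ∷ [] , b₀ ∷ b₁ ∷ b₂ ∷ b₃ ∷ b₄ ∷ b₅ ∷ b₆ ∷ []
       , c₂ ∷ f₂ ∷ c₁ ∷ f₁ ∷ u ∷ []) α β =
    -- With the windows at the places n to n + 6 and the new letters at n + 7, these are `cov₂` and
    -- `cov₁` at n: a closed neighbourhood is charged when its last place is seen.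
    let k₂  = bit a₀ + (bit a₄ + (bit a₆ + (bit α + bit β)))
        k₁  = bit a₀ + (bit b₀ + (bit b₁ + (bit b₃ + bit β)))
        c₂′ = c₂ + pred k₂
        f₂′ = f₂ + (1 ∸ k₂)
        c₁′ = c₁ + pred k₁
        f₁′ = f₁ + (1 ∸ k₁)
        v   = u + 5 * bit α
    -- Every place lowers the balance by 1, so a nonnegative balance after the step means `1 ≤ v`
    -- before the `pred`.
    in if (c₂′ ≤ᵇ C₂) ∧ (f₂′ ≤ᵇ F₂) ∧ (c₁′ ≤ᵇ C₁) ∧ (f₁′ ≤ᵇ F₁) ∧ (1 ≤ᵇ v)
       then ( a₁ ∷ a₂ ∷ a₃ ∷ a₄ ∷ a₅ ∷ a₆ ∷ α ∷ [] , b₁ ∷ b₂ ∷ b₃ ∷ b₄ ∷ b₅ ∷ b₆ ∷ β ∷ []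
            , c₂′ ∷ f₂′ ∷ c₁′ ∷ f₁′ ∷ pred v ∷ []) ∷ []
       else []

  steps : Config → List Config
  steps c = (step c false false ++ step c false true) ++ (step c true false ++ step c true true)

  next : List Config → List Config
  next = concatMap steps

  layer : ℕ → List Config → List Config
  layer zero    L = L
  layer (suc n) L = layer n (next L)

  avoids : Config → ℕ → List Config → Bool
  avoids c zero    L = true
  avoids c (suc n) L = not (does (c ∈? L)) ∧ avoids c n (next L)

  -- Beyond length k, it is enough that layers at distance 5 are nested.
  avoidsForever : Config → ℕ → List Config → Bool
  avoidsForever c zero    L = avoids c 5 L ∧ does (All.all? (_∈? L) (layer 5 L))
  avoidsForever c (suc n) L = not (does (c ∈? L)) ∧ avoidsForever c n (next L)

  -- Holds for the last window of every walk whose balance stays nonnegative and ends in u₁.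
  suffixesLight : ∀ {n} → Vec Bool n → Bool
  suffixesLight []           = true
  suffixesLight {n} (x ∷ xs) = (5 * weight (x ∷ xs) ≤ᵇ n + u₁) ∧ suffixesLight xs

  -- A closed walk returns to its own windows, so its start and its end differ in the counters only.
  initial final : Vec Bool 7 → Vec Bool 7 → Config
  initial A B = A , B , 0 ∷ 0 ∷ 0 ∷ 0 ∷ u₀ ∷ []
  final   A B = A , B , C₂ ∷ F₂ ∷ C₁ ∷ F₁ ∷ u₁ ∷ []

  -- A closed walk starts in its own last window, so starting windows that are not light can be
  -- skipped.
  check : ℕ → (Config → List Config → Bool) → Bool
  check n₀ test = allBits 7 λ A → not (suffixesLight A) ∨ allBits 7 λ B →
    test (final A B) (layer n₀ (initial A B ∷ []))

  step⊆steps : ∀ c α β → step c α β ⊆ steps c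
  step⊆steps c false false p = ∈-++⁺ˡ (∈-++⁺ˡ p)
  step⊆steps c false true  p = ∈-++⁺ˡ (∈-++⁺ʳ (step c false false) p)
  step⊆steps c true  false p = ∈-++⁺ʳ (step c false false ++ _) (∈-++⁺ˡ p)
  step⊆steps c true  true  p = ∈-++⁺ʳ (step c false false ++ _) (∈-++⁺ʳ (step c true false) p)

  next-mono : ∀ {L M} → L ⊆ M → next L ⊆ next M
  next-mono = concatMap⁺ steps

  layer-mono : ∀ n {L M} → L ⊆ M → layer n L ⊆ layer n M
  layer-mono zero    L⊆M = L⊆M
  layer-mono (suc n) L⊆M = layer-mono n (next-mono L⊆M)

  layer-+ : ∀ i j L → layer (i + j) L ≡ layer j (layer i L)
  layer-+ zero    j L = refl
  layer-+ (suc i) j L = layer-+ i j (next L)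

  private
    split : ∀ {x y} → T (x ∧ y) → T x × T y
    split = Equivalence.to T-∧

  ∉-sound : ∀ {c L} → T (not (does (c ∈? L))) → c ∉ₗ L
  ∉-sound {c} {L} t c∈L with c ∈? L
  ... | no c∉L = c∉L c∈L

  avoids-sound : ∀ c k L → T (avoids c k L) → ∀ {j} → j < k → c ∉ₗ layer j L
  avoids-sound c (suc k) L t {zero}  _         = ∉-sound (proj₁ (split t))
  avoids-sound c (suc k) L t {suc j} (s≤s j<k) = avoids-sound c k (next L) (proj₂ (split t)) j<k

  -- Applying the monotone `layer j` to the nesting puts layer 5 + j inside layer j, so by descent
  -- only the first five layers matter.
  layer-mod5 : ∀ {c L} → layer 5 L ⊆ L → (∀ {j} → j < 5 → c ∉ₗ layer j L) → ∀ j → c ∉ₗ layer j L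
  layer-mod5 {c} {L} sub av (suc (suc (suc (suc (suc j))))) c∈ =
    layer-mod5 sub av j (layer-mono j sub c∈)
  layer-mod5 sub av 0 = av (s≤s z≤n)
  layer-mod5 sub av 1 = av (s≤s (s≤s z≤n))
  layer-mod5 sub av 2 = av (s≤s (s≤s (s≤s z≤n)))
  layer-mod5 sub av 3 = av (s≤s (s≤s (s≤s (s≤s z≤n))))
  layer-mod5 sub av 4 = av (s≤s (s≤s (s≤s (s≤s (s≤s z≤n)))))

  dec-sound : ∀ {A : Set} (d : Dec A) → T (does d) → A
  dec-sound (yes a) _ = a

  avoidsForever-sound : ∀ c k L → T (avoidsForever c k L) → ∀ j → c ∉ₗ layer j L
  avoidsForever-sound c zero L t = layer-mod5
    (All.lookup (dec-sound (All.all? (_∈? L) (layer 5 L)) (proj₂ (split {avoids c 5 L} t))))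
    (avoids-sound c 5 L (proj₁ (split {avoids c 5 L} t)))
  avoidsForever-sound c (suc k) L t zero    = ∉-sound (proj₁ (split {not (does (c ∈? L))} t))
  avoidsForever-sound c (suc k) L t (suc j) =
    avoidsForever-sound c k (next L) (proj₂ (split {not (does (c ∈? L))} t)) j

  check-sound : ∀ n₀ test → T (check n₀ test) → ∀ A B → T (suffixesLight A) →
                T (test (final A B) (layer n₀ (initial A B ∷ [])))
  check-sound n₀ test t A B light = allBits-sound 7 {q} (implies (allBits-sound 7 {p} t A) light) B
    where
    p q : Vec Bool 7 → Bool
    p A = not (suffixesLight A) ∨ allBits 7 λ B → test (final A B) (layer n₀ (initial A B ∷ []))
    q B = test (final A B) (layer n₀ (initial A B ∷ []))
    implies : ∀ {x y} → T (not x ∨ y) → T x → T y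
    implies {true} t _ = t

  -- The balance is nonnegative before a suffix and `u₁` after it, while within the suffix each
  -- place lowers it by 1 and each member raises it by 5.
  suffixesLight-window : ∀ a k x → (∀ {y} → y ≤ k + x → y ≤ u₀ + 5 * ∣ a ∣[ y ]) →
    u₀ + 5 * ∣ a ∣[ k + x ] ≡ (k + x) + u₁ → T (suffixesLight (window k a x))
  suffixesLight-window a zero    x low end = tt
  suffixesLight-window a (suc k) x low end = Equivalence.from T-∧
    ( ≤⇒≤ᵇ (+-cancelˡ-≤ x _ _ (begin
        x + 5 * w                          ≤⟨ +-monoˡ-≤ _ (low (m≤n+m x (suc k))) ⟩
        u₀ + 5 * ∣ a ∣[ x ] + 5 * w        ≡⟨ rearrange u₀ ∣ a ∣[ x ] w ⟩
        u₀ + 5 * (∣ a ∣[ x ] + w)          ≡⟨ cong (λ z → u₀ + 5 * z) (∑-weight a (suc k) x) ⟩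
        u₀ + 5 * ∣ a ∣[ suc k + x ]        ≡⟨ end ⟩
        suc k + x + u₁                     ≡⟨ rearrange′ (suc k) x u₁ ⟩
        x + (suc k + u₁)                   ∎))
    , suffixesLight-window a k (suc x)
        (λ {y} le → low (subst (y ≤_) (+-suc k x) le))
        (subst (λ z → u₀ + 5 * ∣ a ∣[ z ] ≡ z + u₁) (sym (+-suc k x)) end))
    where
    open ≤-Reasoning
    w = weight (window (suc k) a x)
    rearrange : ∀ u s w → u + 5 * s + 5 * w ≡ u + 5 * (s + w)
    rearrange = solve-∀
    rearrange′ : ∀ k x u → k + x + u ≡ x + (k + u)
    rearrange′ = solve-∀

  -- `low` expresses that the balance never becomes negative. It counts members from place 7 on,
  -- because these are the letters that enter the window during the walk.
  module Walk (m : ℕ) (a b : Seq) (hp : HasProfile P m a b)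
    (low : ∀ {n} → n ≤ m → n ≤ u₀ + 5 * ∣ (λ x → a (7 + x)) ∣[ n ]) where
    open HasProfile hp

    config : ℕ → Config
    config n = window 7 a n , window 7 b n ,
      excess (cov₂ a b) n ∷ defect (cov₂ a b) n ∷ excess (cov₁ a b) n ∷ defect (cov₁ a b) n ∷
      (u₀ + 5 * ∣ (λ x → a (7 + x)) ∣[ n ] ∸ n) ∷ []

    if-∈ : ∀ {x : Config} {c} → T c → x ∈ₗ (if c then x ∷ [] else [])
    if-∈ {c = true} _ = here refl

    config-step : ∀ {n} → suc n ≤ m → config (suc n) ∈ₗ steps (config n)
    config-step {n} n<m = step⊆steps (config n) (a (7 + n)) (b (7 + n))
      (subst (λ u → config′ u ∈ₗ step (config n) (a (7 + n)) (b (7 + n))) counter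
        (if-∈ (both (bound (λ x → pred (cov₂ a b x)) excess₂) (both (bound (λ x → 1 ∸ cov₂ a b x) defect₂)
              (both (bound (λ x → pred (cov₁ a b x)) excess₁) (both (bound (λ x → 1 ∸ cov₁ a b x) defect₁) positive))))))
      where
      config′ : ℕ → Config
      config′ u = window 7 a (suc n) , window 7 b (suc n) ,
        excess (cov₂ a b) (suc n) ∷ defect (cov₂ a b) (suc n) ∷
        excess (cov₁ a b) (suc n) ∷ defect (cov₁ a b) (suc n) ∷ u ∷ []
      both : ∀ {x y} → T x → T y → T (x ∧ y)
      both p q = Equivalence.from T-∧ (p , q)
      bound : ∀ f {F} → ∑ f m ≡ F → T (∑ f n + f n ≤ᵇ F)
      bound f eq = ≤⇒≤ᵇ (subst (∑ f (suc n) ≤_) eq (∑-mono f n<m))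
      s = ∣ (λ x → a (7 + x)) ∣[ n ]
      α = bit (a (7 + n))
      -- Truncated subtraction commutes with the addition because the balance before the step is
      -- nonnegative.
      value : u₀ + 5 * s ∸ n + 5 * α ≡ u₀ + 5 * (s + α) ∸ n
      value = trans (sym (+-∸-comm (5 * α) (low (≤-trans (n≤1+n n) n<m))))
                    (cong (_∸ n) (distr u₀ s α))
        where
        distr : ∀ u s α → u + 5 * s + 5 * α ≡ u + 5 * (s + α)
        distr = solve-∀
      positive : T (1 ≤ᵇ u₀ + 5 * s ∸ n + 5 * α)
      positive = ≤⇒≤ᵇ (subst (1 ≤_) (sym value) (m<n⇒0<n∸m (low n<m)))
      counter : pred (u₀ + 5 * s ∸ n + 5 * α) ≡ u₀ + 5 * (s + α) ∸ suc n
      counter = trans (cong pred value) (pred[m∸n]≡m∸[1+n] (u₀ + 5 * (s + α)) n)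

    config∈layer : ∀ {n} → n ≤ m → config n ∈ₗ layer n (config 0 ∷ [])
    config∈layer {zero}  _   = here refl
    config∈layer {suc n} n<m = subst (λ k → config (suc n) ∈ₗ layer k (config 0 ∷ [])) (+-comm n 1)
      (subst (config (suc n) ∈ₗ_) (sym (layer-+ n 1 _))
        (∈-concatMap⁺ steps (Any.map (λ { refl → config-step n<m })
          (config∈layer (≤-trans (n≤1+n n) n<m)))))

    total : u₀ + 5 * ∣ (λ x → a (7 + x)) ∣[ m ] ≡ m + u₁
    total = trans (cong (λ z → u₀ + 5 * z)
      (trans (∑-cong m λ x _ → cong (bit ∘ a) (+-comm 7 x)) (∑-shift (cong bit ∘ periodicᵃ) 7))) drift

    window-periodic : ∀ {c} → Periodic m c → window 7 c m ≡ window 7 c 0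
    window-periodic {c} p = window-cong 7 {c} λ i →
      trans (cong c (+-comm i m)) (trans (p i) (cong c (sym (+-identityʳ i))))

    config-end : config m ≡ final (window 7 a 0) (window 7 b 0)
    config-end = cong₂ _,_ (window-periodic periodicᵃ) (cong₂ _,_ (window-periodic periodicᵇ)
      (cong₂ _∷_ excess₂ (cong₂ _∷_ defect₂ (cong₂ _∷_ excess₁ (cong₂ _∷_ defect₁
      (cong (_∷ []) (trans (cong (_∸ m) total) (m+n∸m≡n m u₁))))))))

    config-start : config 0 ≡ initial (window 7 a 0) (window 7 b 0)
    config-start = cong (λ u → window 7 a 0 , window 7 b 0 , 0 ∷ 0 ∷ 0 ∷ 0 ∷ u ∷ []) (+-identityʳ u₀)

    light : 7 ≤ m → T (suffixesLight (window 7 a 0))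
    -- The window at `m ∸ 7` of the sequence shifted by 7 is the window of `a` at `m`, hence by
    -- periodicity the initial one.
    light 7≤m = subst (T ∘ suffixesLight)
      (trans (cong (window 7 a) m≡) (window-periodic periodicᵃ))
      (suffixesLight-window (λ x → a (7 + x)) 7 (m ∸ 7)
        (λ {y} le → low (subst (y ≤_) m≡ le))
        (subst (λ z → u₀ + 5 * ∣ (λ x → a (7 + x)) ∣[ z ] ≡ z + u₁) (sym m≡) total))
      where
      m≡ : 7 + (m ∸ 7) ≡ m
      m≡ = m+[n∸m]≡n 7≤m

    final-reached : 7 ≤ m → T (suffixesLight (window 7 a 0)) ×
      final (window 7 a 0) (window 7 b 0) ∈ₗ layer m (initial (window 7 a 0) (window 7 b 0) ∷ [])
    final-reached 7≤m = light 7≤m , subst₂ (λ c d → c ∈ₗ layer m (d ∷ [])) config-end config-start (config∈layer ≤-refl)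

-- The cycle lemma

minimum : (g : ℕ → ℕ) (m : ℕ) → ∃ λ i → i < suc m × (∀ {x} → x < suc m → g i ≤ g x)
minimum g zero = 0 , s≤s z≤n , λ { {zero} _ → ≤-refl ; {suc _} (s≤s ()) }
minimum g (suc m) with minimum g m
... | i , i< , min with g i ≤? g (suc m)
...   | yes le = i , m<n⇒m<1+n i< , λ {x} x< → case x x<
  where
  case : ∀ x → x < suc (suc m) → g i ≤ g x
  case x (s≤s x≤) with m≤n⇒m<n∨m≡n x≤
  ... | inj₁ lt   = min lt
  ... | inj₂ refl = le
...   | no ≰ = suc m , ≤-refl , λ {x} x< → case x x<
  where
  case : ∀ x → x < suc (suc m) → g (suc m) ≤ g x
  case x (s≤s x≤) with m≤n⇒m<n∨m≡n x≤
  ... | inj₁ lt   = ≤-trans (<⇒≤ (≰⇒> ≰)) (min lt)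
  ... | inj₂ refl = ≤-refl

-- The cycle lemma: start where 5 · (partial sum) − (position) is minimal.
rotation : ∀ {m f u₀ u₁} → 1 ≤ m → Periodic m f → u₀ + 5 * ∑ f m ≡ m + u₁ →
  ∃ λ i → ∀ {n} → n ≤ m → n ≤ u₀ + 5 * ∑ (λ x → f (x + i)) n
rotation {suc m′} {f} {u₀} {u₁} _ p tot = i , bound
  where
  m = suc m′
  g : ℕ → ℕ
  -- The added constant `m` keeps the quantity to be minimised a natural number.
  g x = 5 * ∑ f x + (m ∸ x)
  i = proj₁ (minimum g m′)
  i<m = proj₁ (proj₂ (minimum g m′))
  min : ∀ {x} → x < m → 5 * ∑ f i + x ≤ 5 * ∑ f x + i
  min {x} x<m = +-cancelʳ-≤ (m ∸ x) _ _ (+-cancelʳ-≤ (m ∸ i) _ _ (begin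
    5 * ∑ f i + x + (m ∸ x) + (m ∸ i)   ≡⟨ r₁ (5 * ∑ f i) x (m ∸ x) (m ∸ i) ⟩
    5 * ∑ f i + (m ∸ i) + (x + (m ∸ x)) ≡⟨ cong (g i +_) (m+[n∸m]≡n (<⇒≤ x<m)) ⟩
    g i + m                             ≤⟨ +-monoˡ-≤ m (proj₂ (proj₂ (minimum g m′)) x<m) ⟩
    g x + m                             ≡⟨ cong (g x +_) (m+[n∸m]≡n (<⇒≤ i<m)) ⟨
    5 * ∑ f x + (m ∸ x) + (i + (m ∸ i)) ≡⟨ r₂ (5 * ∑ f x) (m ∸ x) i (m ∸ i) ⟩
    5 * ∑ f x + i + (m ∸ x) + (m ∸ i)   ∎))
    where
    open ≤-Reasoning
    r₁ : ∀ a x y z → a + x + y + z ≡ a + z + (x + y)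
    r₁ = solve-∀
    r₂ : ∀ a y i z → a + y + (i + z) ≡ a + i + y + z
    r₂ = solve-∀
  bound : ∀ {n} → n ≤ m → n ≤ u₀ + 5 * ∑ (λ x → f (x + i)) n
  bound {n} n≤m with n + i <? m
  -- The stretch from `i` ends before `m`, so minimality at `i` is enough.
  ... | yes lt = ≤-trans (+-cancelˡ-≤ (5 * ∑ f i + i) _ _ (begin
      5 * ∑ f i + i + n       ≡⟨ r₁ (5 * ∑ f i) i n ⟩
      5 * ∑ f i + (n + i)     ≤⟨ min lt ⟩
      5 * ∑ f (n + i) + i     ≡⟨ cong (λ z → 5 * z + i) (∑-+ f i n) ⟩
      5 * (∑ f i + s) + i     ≡⟨ r₂ (∑ f i) s i ⟩
      5 * ∑ f i + i + 5 * s   ∎)) (m≤n+m _ u₀)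
    where
    open ≤-Reasoning
    s = ∑ (λ x → f (x + i)) n
    r₁ : ∀ a i n → a + i + n ≡ a + (n + i)
    r₁ = solve-∀
    r₂ : ∀ a s i → 5 * (a + s) + i ≡ 5 * a + i + 5 * s
    r₂ = solve-∀
  -- The stretch wraps around and ends at `y`. Minimality compares `i` with `y`, and the full turn
  -- changes 5 · sum - position by `u₁` - `u₀`, a loss of at most `u₀`.
  ... | no ≮ = +-cancelˡ-≤ (5 * ∑ f i + i) _ _ (begin
      5 * ∑ f i + i + n                   ≡⟨ r₁ (5 * ∑ f i) i n ⟩
      5 * ∑ f i + (n + i)                 ≡⟨ cong (5 * ∑ f i +_) n+i≡ ⟨
      5 * ∑ f i + (y + m)                 ≡⟨ +-assoc (5 * ∑ f i) y m ⟨
      5 * ∑ f i + y + m                   ≤⟨ +-mono-≤ (min y<m) (m≤m+n m u₁) ⟩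
      5 * ∑ f y + i + (m + u₁)            ≡⟨ cong (5 * ∑ f y + i +_) tot ⟨
      5 * ∑ f y + i + (u₀ + 5 * ∑ f m)    ≡⟨ r₂ (∑ f y) i u₀ (∑ f m) ⟩
      u₀ + i + 5 * (∑ f m + ∑ f y)        ≡⟨ cong (λ z → u₀ + i + 5 * (∑ f m + z))
                                               (∑-cong y λ x _ → trans (sym (p x)) (cong f (+-comm m x))) ⟩
      u₀ + i + 5 * (∑ f m + ∑ (λ x → f (x + m)) y) ≡⟨ cong (λ z → u₀ + i + 5 * z) (∑-+ f m y) ⟨
      u₀ + i + 5 * ∑ f (y + m)            ≡⟨ cong (λ z → u₀ + i + 5 * ∑ f z) n+i≡ ⟩
      u₀ + i + 5 * ∑ f (n + i)            ≡⟨ cong (λ z → u₀ + i + 5 * z) (∑-+ f i n) ⟩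
      u₀ + i + 5 * (∑ f i + s)            ≡⟨ r₃ u₀ i (∑ f i) s ⟩
      5 * ∑ f i + i + (u₀ + 5 * s)        ∎)
    where
    open ≤-Reasoning
    s = ∑ (λ x → f (x + i)) n
    y = n + i ∸ m
    n+i≡ : y + m ≡ n + i
    n+i≡ = m∸n+n≡m (≮⇒≥ ≮)
    y<m : y < m
    y<m = +-cancelʳ-< m _ _ (subst (_< m + m) (sym n+i≡) (+-mono-≤-< n≤m i<m))
    r₁ : ∀ a i n → a + i + n ≡ a + (n + i)
    r₁ = solve-∀
    r₂ : ∀ a i u b → 5 * a + i + (u + 5 * b) ≡ u + i + 5 * (b + a)
    r₂ = solve-∀
    r₃ : ∀ u i a s → u + i + 5 * (a + s) ≡ 5 * a + i + (u + 5 * s)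
    r₃ = solve-∀

-- From profiles to walks

periodic-shift : ∀ {A : Set} {m} {c : ℕ → A} → Periodic m c → ∀ i → Periodic m (λ x → c (x + i))
periodic-shift {m = m} {c} p i x = trans (cong c (+-assoc m x i)) (p (x + i))

periodic-shiftˡ : ∀ {A : Set} {m} {c : ℕ → A} → Periodic m c → ∀ i → Periodic m (λ x → c (i + x))
periodic-shiftˡ {m = m} {c} p i x = trans (cong c (x∙yz≈y∙xz i m x)) (p (i + x))

cov₁-periodic : ∀ {m a b} → Periodic m a → Periodic m b → Periodic m (cov₁ a b)
cov₁-periodic p q x
  rewrite p x | q x | periodic-shiftˡ q 1 x | periodic-shiftˡ q 3 x | periodic-shiftˡ q 7 x = refl

cov₂-periodic : ∀ {m a b} → Periodic m a → Periodic m b → Periodic m (cov₂ a b)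
cov₂-periodic p q x
  rewrite p x | periodic-shiftˡ p 4 x | periodic-shiftˡ p 6 x | periodic-shiftˡ p 7 x | periodic-shiftˡ q 7 x = refl

-- All data of a profile are sums over one period and hence invariant under rotation; the rotation
-- is the one that keeps the balance nonnegative, chosen for the sequence shifted by 7 that the walk
-- counts.
profile-reached : ∀ {P m a b} → 7 ≤ m → HasProfile P m a b → let open Search P in
  ∃ λ A → ∃ λ B → T (suffixesLight A) × final A B ∈ₗ layer m (initial A B ∷ [])
profile-reached {P} {m} {a} {b} 7≤m hp =
  window 7 (λ x → a (x + i)) 0 , window 7 (λ x → b (x + i)) 0 , Search.Walk.final-reached P m (λ x → a (x + i)) (λ x → b (x + i)) shifted (proj₂ start) 7≤m
  where
  open HasProfile hp
  open Profile P using (u₀)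
  start = rotation {u₀ = u₀} (≤-trans (s≤s z≤n) 7≤m) (cong bit ∘ periodic-shiftˡ periodicᵃ 7)
    (trans (cong (λ z → u₀ + 5 * z)
      (trans (∑-cong m λ x _ → cong (bit ∘ a) (+-comm 7 x)) (∑-shift (cong bit ∘ periodicᵃ) 7))) drift)
  i = proj₁ start
  covᵖ₁ = cov₁-periodic periodicᵃ periodicᵇ
  covᵖ₂ = cov₂-periodic periodicᵃ periodicᵇ
  shifted : HasProfile P m (λ x → a (x + i)) (λ x → b (x + i))
  shifted = record
    { periodicᵃ = periodic-shift periodicᵃ i
    ; periodicᵇ = periodic-shift periodicᵇ i
    ; excess₂   = trans (∑-shift (cong pred ∘ covᵖ₂) i) excess₂
    ; defect₂   = trans (∑-shift (cong (1 ∸_) ∘ covᵖ₂) i) defect₂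
    ; excess₁   = trans (∑-shift (cong pred ∘ covᵖ₁) i) excess₁
    ; defect₁   = trans (∑-shift (cong (1 ∸_) ∘ covᵖ₁) i) defect₁
    ; drift     = trans (cong (λ z → u₀ + 5 * z) (∑-shift (cong bit ∘ periodicᵃ) i)) drift
    }

-- A walk of length `m` passes through layer `n₀`, from which the search excludes the final
-- configuration after any number of further steps.
no-profile : ∀ P n₀ k → T (Search.check P n₀ (λ c → Search.avoidsForever P c k)) →
  ∀ {m a b} → 7 ≤ m → n₀ ≤ m → ¬ HasProfile P m a b
no-profile P n₀ k t {m} 7≤m n₀≤m hp = refute (profile-reached 7≤m hp)
  where
  open Search P
  refute : ¬ ∃ λ A → ∃ λ B → T (suffixesLight A) × final A B ∈ₗ layer m (initial A B ∷ [])
  refute (A , B , light , reached) = avoidsForever-sound (final A B) k (layer n₀ (initial A B ∷ []))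
    (check-sound n₀ (λ c → avoidsForever c k) t A B light) (m ∸ n₀)
    (subst (final A B ∈ₗ_)
      (trans (cong (λ z → layer z (initial A B ∷ [])) (sym (m+[n∸m]≡n n₀≤m)))
        (layer-+ n₀ (m ∸ n₀) (initial A B ∷ []))) reached)

no-profile-at : ∀ P m → T (Search.check P m (λ c → Search.avoids P c 1)) →
  ∀ {a b} → 7 ≤ m → ¬ HasProfile P m a b
no-profile-at P m t 7≤m hp = refute (profile-reached 7≤m hp)
  where
  open Search P
  refute : ¬ ∃ λ A → ∃ λ B → T (suffixesLight A) × final A B ∈ₗ layer m (initial A B ∷ [])
  refute (A , B , light , reached) = avoids-sound (final A B) 1 (layer m (initial A B ∷ []))
    (check-sound m (λ c → avoids c 1) t A B light) (s≤s z≤n) reached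

-- Double counting of closed neighbourhoods

∑-add : ∀ f g n → ∑ (λ x → f x + g x) n ≡ ∑ f n + ∑ g n
∑-add f g zero    = refl
∑-add f g (suc n) = trans (cong (_+ (f n + g n)) (∑-add f g n)) (interchange (∑ f n) (∑ g n) (f n) (g n))

∑-shiftˡ : ∀ {m f} → Periodic m f → ∀ i → ∑ (λ x → f (i + x)) m ≡ ∑ f m
∑-shiftˡ {m} {f} p i = trans (∑-cong m λ x _ → cong f (+-comm i x)) (∑-shift p i)

-- Pointwise, `c + (1 ∸ c)` and `1 + pred c` are both 1 for c = 0 and both c otherwise.
excess-defect : ∀ c n → ∑ c n + defect c n ≡ n + excess c n
excess-defect c zero    = refl
excess-defect c (suc n) = begin
  ∑ c n + c n + (defect c n + (1 ∸ c n))   ≡⟨ interchange (∑ c n) (c n) (defect c n) (1 ∸ c n) ⟩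
  ∑ c n + defect c n + (c n + (1 ∸ c n))   ≡⟨ cong₂ _+_ (excess-defect c n) (pointwise (c n)) ⟩
  n + excess c n + suc (pred (c n))        ≡⟨ +-suc _ _ ⟩
  suc (n + excess c n + pred (c n))        ≡⟨ cong suc (+-assoc n _ _) ⟩
  suc n + excess c (suc n)                 ∎
  where
  open ≡-Reasoning
  pointwise : ∀ k → k + (1 ∸ k) ≡ suc (pred k)
  pointwise zero    = refl
  pointwise (suc k) = cong suc (trans (cong (k +_) (0∸n≡0 k)) (+-identityʳ k))

∑-cov₂ : ∀ {m a b} → Periodic m a → Periodic m b → ∑ (cov₂ a b) m ≡ 4 * ∣ a ∣[ m ] + ∣ b ∣[ m ]
∑-cov₂ {m} {a} {b} p q
  rewrite ∑-add (bit ∘ a) (λ x → bit (a (4 + x)) + (bit (a (6 + x)) + (bit (a (7 + x)) + bit (b (7 + x))))) m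
        | ∑-add (λ x → bit (a (4 + x))) (λ x → bit (a (6 + x)) + (bit (a (7 + x)) + bit (b (7 + x)))) m
        | ∑-add (λ x → bit (a (6 + x))) (λ x → bit (a (7 + x)) + bit (b (7 + x))) m
        | ∑-add (λ x → bit (a (7 + x))) (λ x → bit (b (7 + x))) m
        | ∑-shiftˡ (cong bit ∘ p) 4 | ∑-shiftˡ (cong bit ∘ p) 6 | ∑-shiftˡ (cong bit ∘ p) 7
        | ∑-shiftˡ (cong bit ∘ q) 7
  = collect ∣ a ∣[ m ] ∣ b ∣[ m ]
  where
  collect : ∀ x y → x + (x + (x + (x + y))) ≡ 4 * x + y
  collect = solve-∀

∑-cov₁ : ∀ {m a b} → Periodic m a → Periodic m b → ∑ (cov₁ a b) m ≡ ∣ a ∣[ m ] + 4 * ∣ b ∣[ m ]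
∑-cov₁ {m} {a} {b} p q
  rewrite ∑-add (bit ∘ a) (λ x → bit (b x) + (bit (b (1 + x)) + (bit (b (3 + x)) + bit (b (7 + x))))) m
        | ∑-add (bit ∘ b) (λ x → bit (b (1 + x)) + (bit (b (3 + x)) + bit (b (7 + x)))) m
        | ∑-add (λ x → bit (b (1 + x))) (λ x → bit (b (3 + x)) + bit (b (7 + x))) m
        | ∑-add (λ x → bit (b (3 + x))) (λ x → bit (b (7 + x))) m
        | ∑-shiftˡ (cong bit ∘ q) 1 | ∑-shiftˡ (cong bit ∘ q) 3 | ∑-shiftˡ (cong bit ∘ q) 7
  = collect ∣ a ∣[ m ] ∣ b ∣[ m ]
  where
  collect : ∀ x y → x + (y + (y + (y + y))) ≡ x + 4 * y
  collect = solve-∀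

-- The excesses are not recorded, since double counting determines them from `m`, the sizes and the
-- defects.
record Arrangement (m x y f₁ f₂ : ℕ) : Set where
  constructor arrangement
  field
    {a b}     : Seq
    periodicᵃ : Periodic m a
    periodicᵇ : Periodic m b
    sizeᵃ     : ∣ a ∣[ m ] ≡ x
    sizeᵇ     : ∣ b ∣[ m ] ≡ y
    defect₁   : defect (cov₁ a b) m ≡ f₁
    defect₂   : defect (cov₂ a b) m ≡ f₂

  double-count₁ : x + 4 * y + f₁ ≡ m + excess (cov₁ a b) m
  double-count₁ = trans
    (sym (cong₂ _+_ (trans (∑-cov₁ periodicᵃ periodicᵇ) (cong₂ (λ s t → s + 4 * t) sizeᵃ sizeᵇ)) defect₁))
    (excess-defect (cov₁ a b) m)

  double-count₂ : 4 * x + y + f₂ ≡ m + excess (cov₂ a b) m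
  double-count₂ = trans
    (sym (cong₂ _+_ (trans (∑-cov₂ periodicᵃ periodicᵇ) (cong₂ (λ s t → 4 * s + t) sizeᵃ sizeᵇ)) defect₂))
    (excess-defect (cov₂ a b) m)

has-profile : ∀ {m x y C₁ C₂ F₁ F₂ u₀ u₁} → Arrangement m x y F₁ F₂ →
  x + 4 * y + F₁ ≡ m + C₁ → 4 * x + y + F₂ ≡ m + C₂ → u₀ + 5 * x ≡ m + u₁ →
  ∃ λ a → ∃ λ b → HasProfile (profile C₂ F₂ C₁ F₁ u₀ u₁) m a b
has-profile {m} {u₀ = u₀} arr eq₁ eq₂ eq₃ = a , b , record
  { periodicᵃ = periodicᵃ
  ; periodicᵇ = periodicᵇ
  ; excess₂   = +-cancelˡ-≡ m _ _ (trans (sym double-count₂) eq₂)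
  ; defect₂   = defect₂
  ; excess₁   = +-cancelˡ-≡ m _ _ (trans (sym double-count₁) eq₁)
  ; defect₁   = defect₁
  ; drift     = trans (cong (λ z → u₀ + 5 * z) sizeᵃ) eq₃
  }
  where open Arrangement arr

-- The symmetry exchanging the two sides

∑-head : ∀ f n → ∑ f (suc n) ≡ f 0 + ∑ (f ∘ suc) n
∑-head f zero    = +-comm 0 (f 0)
∑-head f (suc n) = trans (cong (_+ f (suc n)) (∑-head f n)) (+-assoc (f 0) _ _)

-- The successor is suited to negation modulo m = `suc n`, where -x is represented by m - x =
-- `suc y`.
∑-reverse : ∀ {f g : ℕ → ℕ} n → (∀ {x y} → x + y ≡ n → f x ≡ g (suc y)) → ∑ f (suc n) ≡ ∑ (λ y → g (suc y)) (suc n)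
∑-reverse zero    eq = eq {0} {0} refl
∑-reverse {f} {g} (suc n) eq = begin
  ∑ f (suc n) + f (suc n)                           ≡⟨ cong₂ _+_ (∑-reverse {f} {g ∘ suc} n λ e → eq (trans (+-suc _ _) (cong suc e)))
                                                          (eq {suc n} {0} (+-identityʳ _)) ⟩
  ∑ (λ y → g (2 + y)) (suc n) + g 1                 ≡⟨ +-comm _ (g 1) ⟩
  g 1 + ∑ (λ y → g (2 + y)) (suc n)                 ≡⟨ ∑-head (λ y → g (suc y)) (suc n) ⟨
  ∑ (λ y → g (suc y)) (suc (suc n))                 ∎
  where open ≡-Reasoning

periodic-* : ∀ {A : Set} {m} {c : ℕ → A} → Periodic m c → ∀ j x → c (j * m + x) ≡ c x
periodic-* p zero    x = refl
periodic-* {m = m} {c} p (suc j) x = trans (cong c (+-assoc m (j * m) x)) (trans (p (j * m + x)) (periodic-* p j x))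

-- Multiplication by k = m − 1 is negation modulo m.
module Negation (k : ℕ) where
  m = suc k

  negated : ∀ {A : Set} {c : ℕ → A} → Periodic m c → Periodic m (λ x → c (k * x))
  negated {c = c} p x = trans (cong c (eq k x)) (periodic-* p k (k * x))
    where
    eq : ∀ k x → k * (suc k + x) ≡ k * suc k + k * x
    eq = solve-∀

  ∑-negated : ∀ {f} → Periodic m f → ∑ (λ x → f (k * x)) m ≡ ∑ f m
  ∑-negated {f} p = trans
    (∑-reverse {g = f} k λ {x} {y} e → trans (sym (p (k * x)))
       (trans (cong f (flip-eq k x y e)) (periodic-* p x (suc y))))
    (∑-shiftˡ p 1)
    where
    flip-eq : ∀ k x y → x + y ≡ k → suc k + k * x ≡ x * suc k + suc y
    flip-eq k x y refl = lemma x y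
      where
      lemma : ∀ x y → suc (x + y) + (x + y) * x ≡ x * suc (x + y) + suc y
      lemma = solve-∀

  -- Both arguments are -(j + x) modulo `m`. Taken with i + j = 7, the right-hand form refers all
  -- five terms of a coverage count to the common base point `k * (7 + x)`.
  c-neg : ∀ {A : Set} {c : ℕ → A} → Periodic m c → ∀ j i x → c (k * (j + x)) ≡ c (i + k * ((i + j) + x))
  c-neg {c = c} p j i x = trans (sym (periodic-* p i (k * (j + x)))) (cong c (eq k i j x))
    where
    eq : ∀ k i j x → i * suc k + k * (j + x) ≡ i + k * (i + j + x)
    eq = solve-∀

  module _ {a b : Seq} (p : Periodic m a) (q : Periodic m b) where
    cov₁-negated : ∀ x → cov₁ (λ x → b (k * x)) (λ x → a (k * x)) x ≡ cov₂ a b (k * (7 + x))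
    cov₁-negated x = trans
      (cong₂ _+_ (cong bit (c-neg q 0 7 x)) (cong₂ _+_ (cong bit (c-neg p 0 7 x)) (cong₂ _+_ (cong bit (c-neg p 1 6 x))
        (cong₂ _+_ (cong bit (c-neg p 3 4 x)) (cong bit (c-neg p 7 0 x))))))
      (lemma (bit (b (7 + y))) (bit (a (7 + y))) (bit (a (6 + y))) (bit (a (4 + y))) (bit (a y)))
      where
      y = k * (7 + x)
      lemma : ∀ b₇ a₇ a₆ a₄ a₀ → b₇ + (a₇ + (a₆ + (a₄ + a₀))) ≡ a₀ + (a₄ + (a₆ + (a₇ + b₇)))
      lemma = solve-∀

    cov₂-negated : ∀ x → cov₂ (λ x → b (k * x)) (λ x → a (k * x)) x ≡ cov₁ a b (k * (7 + x))
    cov₂-negated x = trans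
      (cong₂ _+_ (cong bit (c-neg q 0 7 x)) (cong₂ _+_ (cong bit (c-neg q 4 3 x)) (cong₂ _+_ (cong bit (c-neg q 6 1 x))
        (cong₂ _+_ (cong bit (c-neg q 7 0 x)) (cong bit (c-neg p 7 0 x))))))
      (lemma (bit (b (7 + y))) (bit (b (3 + y))) (bit (b (1 + y))) (bit (b y)) (bit (a y)))
      where
      y = k * (7 + x)
      lemma : ∀ b₇ b₃ b₁ b₀ a₀ → b₇ + (b₃ + (b₁ + (b₀ + a₀))) ≡ a₀ + (b₀ + (b₁ + (b₃ + b₇)))
      lemma = solve-∀

-- Exchanging the sides while negating the places, (1 , j) ↦ (2 , -j) and (2 , j) ↦ (1 , -j), is an
-- automorphism of the graph. It interchanges `cov₁` and `cov₂` up to a change of position.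
reflect : ∀ {m x y f₁ f₂} → 1 ≤ m → Arrangement m x y f₁ f₂ → Arrangement m y x f₂ f₁
reflect {suc k} _ arr = record
  { a = λ x → b (k * x)
  ; b = λ x → a (k * x)
  ; periodicᵃ = negated periodicᵇ
  ; periodicᵇ = negated periodicᵃ
  ; sizeᵃ     = trans (∑-negated (cong bit ∘ periodicᵇ)) sizeᵇ
  ; sizeᵇ     = trans (∑-negated (cong bit ∘ periodicᵃ)) sizeᵃ
  ; defect₁   = trans (∑-cong m λ x _ → cong (1 ∸_) (cov₁-negated periodicᵃ periodicᵇ x))
                  (trans (back (cong (1 ∸_) ∘ cov₂-periodic periodicᵃ periodicᵇ)) defect₂)
  ; defect₂   = trans (∑-cong m λ x _ → cong (1 ∸_) (cov₂-negated periodicᵃ periodicᵇ x))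
                  (trans (back (cong (1 ∸_) ∘ cov₁-periodic periodicᵃ periodicᵇ)) defect₁)
  }
  where
  open Arrangement arr
  open Negation k
  back : ∀ {f} → Periodic m f → ∑ (λ x → f (k * (7 + x))) m ≡ ∑ f m
  back p = trans (∑-shiftˡ (negated p) 7) (∑-negated p)

-- The excluded profiles

open Search using (check; avoids; avoidsForever)

-- The profiles to be excluded for m = r + 5q, with r the digit of the name.  The sizes of the two sides are
-- q and 1+q for P₁ and P₂, q and 2+q for P₃, 1+q and 2+q for P₄, and 1+q and 1+q for the others.
P₁ P₂ P₃ P₃′ P₃″ P₄ P₄′ P₄″ : Profile
P₁  = profile 0 0 3 0 1 0
P₂  = profile 0 1 2 0 2 0
P₃  = profile 0 1 5 0 3 0
P₃′ = profile 2 0 2 0 0 2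
P₃″ = profile 2 0 3 1 0 2
P₄  = profile 2 0 5 0 0 1
P₄′ = profile 1 0 1 0 0 1
P₄″ = profile 1 0 2 1 0 1

-- The searches are kept behind record types: types mentioning them are then compared by name instead of by
-- running the search.
record NeverFrom (P : Profile) (n₀ : ℕ) : Set where
  constructor searched
  field
    k  : ℕ
    ok : check P n₀ (λ c → avoidsForever P c k) ≡ true

record NeverAt (P : Profile) (m : ℕ) : Set where
  constructor searched
  field
    ok : check P m (λ c → avoids P c 1) ≡ true

never₁ : NeverFrom P₁ 11
never₁ = searched 0 refl

never₂ : NeverFrom P₂ 12
never₂ = searched 0 refl

never₃ : NeverFrom P₃ 23
never₃ = searched 0 refl

never₃′ : NeverFrom P₃′ 23
never₃′ = searched 0 refl

never₃″ : NeverFrom P₃″ 23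
never₃″ = searched 0 refl

never₄ : NeverFrom P₄ 19
-- The lengths 19 to 22 are checked one by one; nesting at distance 5 is tested at length 23.
never₄ = searched 4 refl

never₄′ : NeverFrom P₄′ 14
never₄′ = searched 0 refl

never₄″ : NeverFrom P₄″ 14
never₄″ = searched 0 refl

-- P₃′ does occur for m = 18, so m = 13 needs a search of its own.
never-at₁₃ : NeverAt P₃′ 13
never-at₁₃ = searched refl

never : ∀ {P n₀ m a b} → NeverFrom P n₀ → 7 ≤ m → n₀ ≤ m → ¬ HasProfile P m a b
never {P} {n₀} nf = no-profile P n₀ k (subst T (sym ok) tt)
  where open NeverFrom nf

-- An explicit gap `d` turns a linear inequality into an identity for the ring solver.
slack : ∀ d {m n} → m + d ≡ n → m ≤ n
slack d {m} refl = m≤m+n m d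

residue-mono : ∀ r {k q} → k ≤ q → r + k * 5 ≤ r + q * 5
residue-mono r k≤q = +-monoʳ-≤ r (*-monoˡ-≤ 5 k≤q)

excluded : ∀ {P n₀ m x y} → let open Profile P in NeverFrom P n₀ → 7 ≤ n₀ → n₀ ≤ m →
  x + 4 * y + F₁ ≡ m + C₁ → 4 * x + y + F₂ ≡ m + C₂ → u₀ + 5 * x ≡ m + u₁ → ¬ Arrangement m x y F₁ F₂
excluded nf 7≤n₀ n₀≤m eq₁ eq₂ eq₃ arr with has-profile arr eq₁ eq₂ eq₃
... | _ , _ , hp = never nf (≤-trans 7≤n₀ n₀≤m) n₀≤m hp

excluded₁ : ∀ {q} → 2 ≤ q → ¬ Arrangement (1 + q * 5) q (1 + q) 0 0
excluded₁ {q} 2≤q = excluded never₁ (m≤m+n 7 4) (residue-mono 1 2≤q) (e₁ q) (e₂ q) (e₃ q)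
  where
  e₁ : ∀ q → q + 4 * (1 + q) + 0 ≡ 1 + q * 5 + 3
  e₁ = solve-∀
  e₂ : ∀ q → 4 * q + (1 + q) + 0 ≡ 1 + q * 5 + 0
  e₂ = solve-∀
  e₃ : ∀ q → 1 + 5 * q ≡ 1 + q * 5 + 0
  e₃ = solve-∀

excluded₂ : ∀ {q} → 2 ≤ q → ¬ Arrangement (2 + q * 5) q (1 + q) 0 1
excluded₂ {q} 2≤q = excluded never₂ (m≤m+n 7 5) (residue-mono 2 2≤q) (e₁ q) (e₂ q) (e₃ q)
  where
  e₁ : ∀ q → q + 4 * (1 + q) + 0 ≡ 2 + q * 5 + 2
  e₁ = solve-∀
  e₂ : ∀ q → 4 * q + (1 + q) + 1 ≡ 2 + q * 5 + 0
  e₂ = solve-∀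
  e₃ : ∀ q → 2 + 5 * q ≡ 2 + q * 5 + 0
  e₃ = solve-∀

excluded₃ : ∀ {q} → 4 ≤ q → ¬ Arrangement (3 + q * 5) q (2 + q) 0 1
excluded₃ {q} 4≤q = excluded never₃ (m≤m+n 7 16) (residue-mono 3 4≤q) (e₁ q) (e₂ q) (e₃ q)
  where
  e₁ : ∀ q → q + 4 * (2 + q) + 0 ≡ 3 + q * 5 + 5
  e₁ = solve-∀
  e₂ : ∀ q → 4 * q + (2 + q) + 1 ≡ 3 + q * 5 + 0
  e₂ = solve-∀
  e₃ : ∀ q → 3 + 5 * q ≡ 3 + q * 5 + 0
  e₃ = solve-∀

excluded₃′ : ∀ {q} → 4 ≤ q → ¬ Arrangement (3 + q * 5) (1 + q) (1 + q) 0 0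
excluded₃′ {q} 4≤q = excluded never₃′ (m≤m+n 7 16) (residue-mono 3 4≤q) (e₁ q) (e₂ q) (e₃ q)
  where
  e₁ : ∀ q → (1 + q) + 4 * (1 + q) + 0 ≡ 3 + q * 5 + 2
  e₁ = solve-∀
  e₂ : ∀ q → 4 * (1 + q) + (1 + q) + 0 ≡ 3 + q * 5 + 2
  e₂ = solve-∀
  e₃ : ∀ q → 5 * (1 + q) ≡ 3 + q * 5 + 2
  e₃ = solve-∀

excluded₃″ : ∀ {q} → 4 ≤ q → ¬ Arrangement (3 + q * 5) (1 + q) (1 + q) 1 0
excluded₃″ {q} 4≤q = excluded never₃″ (m≤m+n 7 16) (residue-mono 3 4≤q) (e₁ q) (e₂ q) (e₃ q)
  where
  e₁ : ∀ q → (1 + q) + 4 * (1 + q) + 1 ≡ 3 + q * 5 + 3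
  e₁ = solve-∀
  e₂ : ∀ q → 4 * (1 + q) + (1 + q) + 0 ≡ 3 + q * 5 + 2
  e₂ = solve-∀
  e₃ : ∀ q → 5 * (1 + q) ≡ 3 + q * 5 + 2
  e₃ = solve-∀

excluded-at : ∀ {P m x y} → let open Profile P in NeverAt P m → 7 ≤ m →
  x + 4 * y + F₁ ≡ m + C₁ → 4 * x + y + F₂ ≡ m + C₂ → u₀ + 5 * x ≡ m + u₁ → ¬ Arrangement m x y F₁ F₂
excluded-at {P} {m} na 7≤m eq₁ eq₂ eq₃ arr with has-profile arr eq₁ eq₂ eq₃
... | _ , _ , hp = no-profile-at P m (subst T (sym (NeverAt.ok na)) tt) 7≤m hp

excluded₁₃ : ¬ Arrangement 13 3 3 0 0
excluded₁₃ = excluded-at never-at₁₃ (m≤m+n 7 6) refl refl refl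

excluded₄ : ∀ {q} → 3 ≤ q → ¬ Arrangement (4 + q * 5) (1 + q) (2 + q) 0 0
excluded₄ {q} 3≤q = excluded never₄ (m≤m+n 7 12) (residue-mono 4 3≤q) (e₁ q) (e₂ q) (e₃ q)
  where
  e₁ : ∀ q → (1 + q) + 4 * (2 + q) + 0 ≡ 4 + q * 5 + 5
  e₁ = solve-∀
  e₂ : ∀ q → 4 * (1 + q) + (2 + q) + 0 ≡ 4 + q * 5 + 2
  e₂ = solve-∀
  e₃ : ∀ q → 5 * (1 + q) ≡ 4 + q * 5 + 1
  e₃ = solve-∀

excluded₄′ : ∀ {q} → 2 ≤ q → ¬ Arrangement (4 + q * 5) (1 + q) (1 + q) 0 0
excluded₄′ {q} 2≤q = excluded never₄′ (m≤m+n 7 7) (residue-mono 4 2≤q) (e₁ q) (e₁′ q) (e₃ q)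
  where
  e₁ : ∀ q → (1 + q) + 4 * (1 + q) + 0 ≡ 4 + q * 5 + 1
  e₁ = solve-∀
  e₁′ : ∀ q → 4 * (1 + q) + (1 + q) + 0 ≡ 4 + q * 5 + 1
  e₁′ = solve-∀
  e₃ : ∀ q → 5 * (1 + q) ≡ 4 + q * 5 + 1
  e₃ = solve-∀

excluded₄″ : ∀ {q} → 2 ≤ q → ¬ Arrangement (4 + q * 5) (1 + q) (1 + q) 1 0
excluded₄″ {q} 2≤q = excluded never₄″ (m≤m+n 7 7) (residue-mono 4 2≤q) (e₁ q) (e₂ q) (e₃ q)
  where
  e₁ : ∀ q → (1 + q) + 4 * (1 + q) + 1 ≡ 4 + q * 5 + 2
  e₁ = solve-∀
  e₂ : ∀ q → 4 * (1 + q) + (1 + q) + 0 ≡ 4 + q * 5 + 1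
  e₂ = solve-∀
  e₃ : ∀ q → 5 * (1 + q) ≡ 4 + q * 5 + 1
  e₃ = solve-∀

-- Constraints on the sizes of the two sides

covering₂ : ∀ {m x y f₁ f₂} → Arrangement m x y f₁ f₂ → m ≤ 4 * x + y + f₂
covering₂ {m} arr = subst (m ≤_) (sym (Arrangement.double-count₂ arr)) (m≤m+n m _)

-- Covering side 2 needs m ≤ 4x + y + f ≤ 3x + K + f. For x ≤ s - 1 the right-hand side is at most
-- 3s + K + f - 3, and the hypothesis makes this less than m.
x-≥ : ∀ {K m x y f} s → x + y ≤ K → m ≤ 4 * x + y + f → 3 * s + K + f ≤ 2 + m → s ≤ x
x-≥ {K} {m} {x} {y} {f} s x+y≤K cov bnd = ≮⇒≥ λ x<s → 1+n≰n {2 + (3 * x + K + f)} (begin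
  suc (2 + (3 * x + K + f))  ≡⟨ r₁ x K f ⟩
  3 * suc x + K + f          ≤⟨ +-monoˡ-≤ f (+-monoˡ-≤ K (*-monoʳ-≤ 3 x<s)) ⟩
  3 * s + K + f              ≤⟨ bnd ⟩
  2 + m                      ≤⟨ +-monoʳ-≤ 2 cov ⟩
  2 + (4 * x + y + f)        ≡⟨ cong (2 +_) (r₂ x y f) ⟩
  2 + (3 * x + (x + y) + f)  ≤⟨ +-monoʳ-≤ 2 (+-monoˡ-≤ f (+-monoʳ-≤ (3 * x) x+y≤K)) ⟩
  2 + (3 * x + K + f)        ∎)
  where
  open ≤-Reasoning
  r₁ : ∀ x K f → suc (2 + (3 * x + K + f)) ≡ 3 * suc x + K + f
  r₁ = solve-∀
  r₂ : ∀ x y f → 4 * x + y + f ≡ 3 * x + (x + y) + f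
  r₂ = solve-∀

x-≤ : ∀ {K x y} s → x ≤ y → x + y ≤ K → K ≤ 1 + 2 * s → x ≤ s
x-≤ {K} {x} {y} s x≤y x+y≤K bnd = ≮⇒≥ λ s<x → 1+n≰n {1 + 2 * s} (begin
  suc (1 + 2 * s) ≡⟨ r s ⟩
  suc s + suc s   ≤⟨ +-mono-≤ s<x (≤-trans s<x x≤y) ⟩
  x + y           ≤⟨ x+y≤K ⟩
  K               ≤⟨ bnd ⟩
  1 + 2 * s       ∎)
  where
  open ≤-Reasoning
  r : ∀ s → suc (1 + 2 * s) ≡ suc s + suc s
  r = solve-∀

y-≥ : ∀ {m y} c f t → m ≤ c + y + f → c + t + f ≡ m → t ≤ y
y-≥ c f t cov refl = +-cancelˡ-≤ c _ _ (+-cancelʳ-≤ f _ _ cov)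

y-≤ : ∀ {K y} x t → x + y ≤ K → K ≡ x + t → y ≤ t
y-≤ x t le refl = +-cancelˡ-≤ x _ _ le

-- `F` is 0 for dominating sets, and 1 for sets that may miss one vertex, namely the deleted one.
LowerBound : ℕ → ℕ → ℕ → Set
LowerBound F m k = ∀ {x y f₁ f₂} → f₁ + f₂ ≤ F → Arrangement m x y f₁ f₂ → k ≤ x + y

-- `reflect` exchanges the sizes and the defects, so the first side may be taken to be the smaller
-- one.
wlog : ∀ {F m k} → 1 ≤ m →
  (∀ {x y f₁ f₂} → x ≤ y → f₁ + f₂ ≤ F → Arrangement m x y f₁ f₂ → ¬ x + y < k) → LowerBound F m k
wlog {F} {k = k} 1≤m small {x} {y} {f₁} {f₂} f≤F arr with ≤-total x y
... | inj₁ x≤y = ≮⇒≥ (small x≤y f≤F arr)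
... | inj₂ y≤x = subst (k ≤_) (+-comm y x)
      (≮⇒≥ (small y≤x (subst (_≤ F) (+-comm f₁ f₂) f≤F) (reflect 1≤m arr)))

f₂≤ : ∀ {f₁ f₂ F} → f₁ + f₂ ≤ F → f₂ ≤ F
f₂≤ {f₁} {f₂} = ≤-trans (m≤n+m f₂ f₁)

-- Lower bounds for m = r + 5q

data ≤1-Cases : ℕ → ℕ → Set where
  none   : ≤1-Cases 0 0
  first  : ≤1-Cases 1 0
  second : ≤1-Cases 0 1

≤1-cases : ∀ f₁ f₂ → f₁ + f₂ ≤ 1 → ≤1-Cases f₁ f₂
≤1-cases zero          zero          _ = none
≤1-cases (suc zero)    zero          _ = first
≤1-cases zero          (suc zero)    _ = second
≤1-cases zero          (suc (suc _)) (s≤s ())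
≤1-cases (suc (suc _)) f₂            (s≤s ())
≤1-cases (suc zero)    (suc f₂)      (s≤s ())

-- Counting alone suffices: with at most 2q + 1 members the smaller side has at most q, too few to
-- cover side 2 up to one vertex.
lower₀ : ∀ {q} → LowerBound 1 (suc q * 5) (suc q * 2)
lower₀ {q} = wlog (s≤s z≤n) λ {x} {y} {f₁} {f₂} x≤y f≤1 arr small →
  let x≤q = x-≤ q x≤y (≤-pred small) (slack 0 (e₁ q))
  in <⇒≱ (x-≥ (suc q) (≤-pred small) (covering₂ arr)
       (≤-trans (+-monoʳ-≤ (3 * suc q + (1 + q * 2)) (f₂≤ {f₁} f≤1)) (slack 2 (e₂ q)))) x≤q
  where
  e₁ : ∀ q → 1 + q * 2 + 0 ≡ 1 + 2 * q
  e₁ = solve-∀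
  e₂ : ∀ q → 3 * suc q + (1 + q * 2) + 1 + 2 ≡ 2 + suc q * 5
  e₂ = solve-∀

-- Counting leaves only the sizes q and q + 1, for which side 2 is covered without any overlap; the
-- search excludes them.
lower₁ : ∀ {q} → 2 ≤ q → LowerBound 0 (1 + q * 5) (2 + q * 2)
lower₁ {q} 2≤q = wlog (s≤s z≤n) small
  where
  e₁ : ∀ q → 1 + q * 2 + 0 ≡ 1 + 2 * q
  e₁ = solve-∀
  e₂ : ∀ q → 3 * q + (1 + q * 2) + 0 + 2 ≡ 2 + (1 + q * 5)
  e₂ = solve-∀
  e₃ : ∀ q → 4 * q + (1 + q) + 0 ≡ 1 + q * 5
  e₃ = solve-∀
  e₄ : ∀ q → 1 + q * 2 ≡ q + (1 + q)
  e₄ = solve-∀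
  case : ∀ {x y} → x ≡ q → x + y ≤ 1 + q * 2 → Arrangement (1 + q * 5) x y 0 0 → ⊥
  case refl x+y≤K arr with ≤-antisym (y-≤ q (1 + q) x+y≤K (e₄ q)) (y-≥ (4 * q) 0 (1 + q) (covering₂ arr) (e₃ q))
  ... | refl = excluded₁ 2≤q arr
  small : ∀ {x y f₁ f₂} → x ≤ y → f₁ + f₂ ≤ 0 → Arrangement (1 + q * 5) x y f₁ f₂ → ¬ x + y < 2 + q * 2
  small {f₁ = zero} {zero} x≤y _ arr (s≤s x+y≤K) =
    case (≤-antisym (x-≤ q x≤y x+y≤K (slack 0 (e₁ q)))
                    (x-≥ q x+y≤K (covering₂ arr) (slack 2 (e₂ q)))) x+y≤K arr

-- Counting forces x = q, and then y = q + 1 is possible only if the missed vertex lies on side 2.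
lower₂ : ∀ {q} → 2 ≤ q → LowerBound 1 (2 + q * 5) (2 + q * 2)
lower₂ {q} 2≤q = wlog (s≤s z≤n) λ {x} {y} {f₁} {f₂} x≤y f≤1 arr → λ where
    (s≤s x+y≤K) →
      case (≤-antisym (x-≤ q x≤y x+y≤K (slack 0 (e₁ q)))
                      (x-≥ q x+y≤K (covering₂ arr)
                        (≤-trans (+-monoʳ-≤ (3 * q + (1 + q * 2)) (f₂≤ {f₁} f≤1)) (slack 2 (e₂ q)))))
           f≤1 x+y≤K arr
  where
  e₁ : ∀ q → 1 + q * 2 + 0 ≡ 1 + 2 * q
  e₁ = solve-∀
  e₂ : ∀ q → 3 * q + (1 + q * 2) + 1 + 2 ≡ 2 + (2 + q * 5)
  e₂ = solve-∀
  e₃ : ∀ q → 4 * q + (2 + q) + 0 ≡ 2 + q * 5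
  e₃ = solve-∀
  e₃′ : ∀ q → 4 * q + (1 + q) + 1 ≡ 2 + q * 5
  e₃′ = solve-∀
  e₄ : ∀ q → 1 + q * 2 ≡ q + (1 + q)
  e₄ = solve-∀
  case : ∀ {x y f₁ f₂} → x ≡ q → f₁ + f₂ ≤ 1 → x + y ≤ 1 + q * 2 → Arrangement (2 + q * 5) x y f₁ f₂ → ⊥
  case {f₁ = f₁} {f₂} refl f≤1 x+y≤K arr with ≤1-cases f₁ f₂ f≤1
  ... | none  = <⇒≱ (y-≥ (4 * q) 0 (2 + q) (covering₂ arr) (e₃ q)) (y-≤ q (1 + q) x+y≤K (e₄ q))
  ... | first = <⇒≱ (y-≥ (4 * q) 0 (2 + q) (covering₂ arr) (e₃ q)) (y-≤ q (1 + q) x+y≤K (e₄ q))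
  ... | second with ≤-antisym (y-≤ q (1 + q) x+y≤K (e₄ q)) (y-≥ (4 * q) 1 (1 + q) (covering₂ arr) (e₃′ q))
  ...   | refl = excluded₂ 2≤q arr

-- Counting alone gives this weaker bound, which is attained for m = 8, 9 and 18.
lower₃₄ : ∀ {q r} → 3 ≤ r → LowerBound 1 (r + q * 5) (2 + q * 2)
lower₃₄ {q} {r} 3≤r = wlog (≤-trans (m≤m+n 1 2) (≤-trans 3≤r (m≤m+n r _))) λ {x} {y} {f₁} {f₂} x≤y f≤1 arr → λ where
    (s≤s x+y≤K) → <⇒≱
      (x-≥ (1 + q) x+y≤K (covering₂ arr)
        (≤-trans (+-monoʳ-≤ (3 * (1 + q) + (1 + q * 2)) (f₂≤ {f₁} f≤1))
          (≤-trans (slack 0 (e₂ q)) (+-monoʳ-≤ 2 (+-monoˡ-≤ (q * 5) 3≤r)))))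
      (x-≤ q x≤y x+y≤K (slack 0 (e₁ q)))
  where
  e₁ : ∀ q → 1 + q * 2 + 0 ≡ 1 + 2 * q
  e₁ = solve-∀
  e₂ : ∀ q → 3 * (1 + q) + (1 + q * 2) + 1 + 0 ≡ 2 + (3 + q * 5)
  e₂ = solve-∀

-- Two pairs of sizes survive counting: q and q + 2, which requires a missed vertex on side 2, and q
-- + 1 twice. Their exclusion is a hypothesis because m = 13 and large m rely on different searches.
lower₃ : ∀ {F q} → F ≤ 1 → (1 ≤ F → ¬ Arrangement (3 + q * 5) q (2 + q) 0 1) →
  (∀ {f₁ f₂} → f₁ + f₂ ≤ F → ¬ Arrangement (3 + q * 5) (1 + q) (1 + q) f₁ f₂) →
  LowerBound F (3 + q * 5) (3 + q * 2)
lower₃ {F} {q} F≤1 unbalanced balanced = wlog (s≤s z≤n) λ {x} {y} {f₁} {f₂} x≤y f≤F arr → λ where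
    (s≤s x+y≤K) →
      case (m≤n⇒m<n∨m≡n (x-≥ q x+y≤K (covering₂ arr)
                        (≤-trans (+-monoʳ-≤ (3 * q + (2 + q * 2)) (f₂≤ {f₁} (≤-trans f≤F F≤1))) (slack 2 (e₂ q)))))
           (x-≤ (1 + q) x≤y x+y≤K (slack 1 (e₁ q))) x≤y
           f≤F x+y≤K arr
  where
  e₁ : ∀ q → 2 + q * 2 + 1 ≡ 1 + 2 * (1 + q)
  e₁ = solve-∀
  e₂ : ∀ q → 3 * q + (2 + q * 2) + 1 + 2 ≡ 2 + (3 + q * 5)
  e₂ = solve-∀
  e₃ : ∀ q → 4 * q + (3 + q) + 0 ≡ 3 + q * 5
  e₃ = solve-∀
  e₃′ : ∀ q → 4 * q + (2 + q) + 1 ≡ 3 + q * 5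
  e₃′ = solve-∀
  e₄ : ∀ q → 2 + q * 2 ≡ q + (2 + q)
  e₄ = solve-∀
  e₅ : ∀ q → 2 + q * 2 ≡ (1 + q) + (1 + q)
  e₅ = solve-∀
  case : ∀ {x y f₁ f₂} → q < x ⊎ q ≡ x → x ≤ 1 + q → x ≤ y →
    f₁ + f₂ ≤ F → x + y ≤ 2 + q * 2 → Arrangement (3 + q * 5) x y f₁ f₂ → ⊥
  case (inj₁ q<x) x≤ x≤y f≤F x+y≤K arr with ≤-antisym q<x x≤
  ... | refl with ≤-antisym x≤y (y-≤ (1 + q) (1 + q) x+y≤K (e₅ q))
  ...   | refl = balanced f≤F arr
  case {f₁ = f₁} {f₂} (inj₂ refl) _ _ f≤F x+y≤K arr with ≤1-cases f₁ f₂ (≤-trans f≤F F≤1)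
  ... | none = <⇒≱ (y-≥ (4 * q) 0 (3 + q) (covering₂ arr) (e₃ q)) (y-≤ q (2 + q) x+y≤K (e₄ q))
  ... | first = <⇒≱ (y-≥ (4 * q) 0 (3 + q) (covering₂ arr) (e₃ q)) (y-≤ q (2 + q) x+y≤K (e₄ q))
  ... | second with ≤-antisym (y-≤ q (2 + q) x+y≤K (e₄ q)) (y-≥ (4 * q) 1 (2 + q) (covering₂ arr) (e₃′ q))
  ...   | refl = unbalanced f≤F arr

lower₃-generic : ∀ {q} → 4 ≤ q → LowerBound 1 (3 + q * 5) (3 + q * 2)
lower₃-generic {q} 4≤q = lower₃ ≤-refl (λ _ → excluded₃ 4≤q) balanced
  where
  balanced : ∀ {f₁ f₂} → f₁ + f₂ ≤ 1 → ¬ Arrangement (3 + q * 5) (1 + q) (1 + q) f₁ f₂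
  balanced {f₁} {f₂} f≤1 arr with ≤1-cases f₁ f₂ f≤1
  ... | none   = excluded₃′ 4≤q arr
  ... | first  = excluded₃″ 4≤q arr
  ... | second = excluded₃″ 4≤q (reflect (s≤s z≤n) arr)

lower₁₃ : LowerBound 0 13 7
lower₁₃ = lower₃ {q = 2} z≤n (λ ()) λ { {zero} {zero} _ → excluded₁₃ }

-- Counting leaves two sides of size q + 1. For equal sizes `reflect` moves a missed vertex from
-- side 2 to side 1, so two searches suffice.
lower₄-but : ∀ {q} → 2 ≤ q → LowerBound 1 (4 + q * 5) (3 + q * 2)
lower₄-but {q} 2≤q = wlog (s≤s z≤n) λ {x} {y} {f₁} {f₂} x≤y f≤1 arr → λ where
    (s≤s x+y≤K) →
      case (≤-antisym (x-≤ (1 + q) x≤y x+y≤K (slack 1 (e₁ q)))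
                      (x-≥ (1 + q) x+y≤K (covering₂ arr)
                        (≤-trans (+-monoʳ-≤ (3 * (1 + q) + (2 + q * 2)) (f₂≤ {f₁} f≤1)) (slack 0 (e₂ q)))))
           x≤y f≤1 x+y≤K arr
  where
  e₁ : ∀ q → 2 + q * 2 + 1 ≡ 1 + 2 * (1 + q)
  e₁ = solve-∀
  e₂ : ∀ q → 3 * (1 + q) + (2 + q * 2) + 1 + 0 ≡ 2 + (4 + q * 5)
  e₂ = solve-∀
  e₅ : ∀ q → 2 + q * 2 ≡ (1 + q) + (1 + q)
  e₅ = solve-∀
  case : ∀ {x y f₁ f₂} → x ≡ 1 + q → x ≤ y → f₁ + f₂ ≤ 1 → x + y ≤ 2 + q * 2 →
    Arrangement (4 + q * 5) x y f₁ f₂ → ⊥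
  case {f₁ = f₁} {f₂} refl x≤y f≤1 x+y≤K arr
    with ≤-antisym x≤y (y-≤ (1 + q) (1 + q) x+y≤K (e₅ q)) | ≤1-cases f₁ f₂ f≤1
  ... | refl | none   = excluded₄′ 2≤q arr
  ... | refl | first  = excluded₄″ 2≤q arr
  ... | refl | second = excluded₄″ 2≤q (reflect (s≤s z≤n) arr)

-- Counting leaves q + 1 against q + 1 or q + 2, and the search excludes both. The bound is one more
-- than in `lower₄-but`, and this gap is the source of instability.
lower₄ : ∀ {q} → 3 ≤ q → LowerBound 0 (4 + q * 5) (4 + q * 2)
lower₄ {q} 3≤q = wlog (s≤s z≤n) small
  where
  e₁ : ∀ q → 3 + q * 2 + 0 ≡ 1 + 2 * (1 + q)
  e₁ = solve-∀
  e₂ : ∀ q → 3 * (1 + q) + (3 + q * 2) + 0 + 0 ≡ 2 + (4 + q * 5)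
  e₂ = solve-∀
  e₅ : ∀ q → 3 + q * 2 ≡ (1 + q) + (2 + q)
  e₅ = solve-∀
  case : ∀ {x y} → x ≡ 1 + q → x ≤ y → x + y ≤ 3 + q * 2 → Arrangement (4 + q * 5) x y 0 0 → ⊥
  case refl x≤y x+y≤K arr with m≤n⇒m<n∨m≡n x≤y
  ... | inj₂ refl = excluded₄′ (≤-trans (n≤1+n 2) 3≤q) arr
  ... | inj₁ x<y with ≤-antisym x<y (y-≤ (1 + q) (2 + q) x+y≤K (e₅ q))
  ...   | refl = excluded₄ 3≤q arr
  small : ∀ {x y f₁ f₂} → x ≤ y → f₁ + f₂ ≤ 0 → Arrangement (4 + q * 5) x y f₁ f₂ → ¬ x + y < 4 + q * 2
  small {f₁ = zero} {zero} x≤y _ arr (s≤s x+y≤K) =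
    case (≤-antisym (x-≤ (1 + q) x≤y x+y≤K (slack 0 (e₁ q)))
                    (x-≥ (1 + q) x+y≤K (covering₂ arr) (slack 0 (e₂ q))))
         x≤y x+y≤K arr

T⇒∈ : ∀ {n} {D : Subset n} {v} → T (lookup D v) → v ∈ D
T⇒∈ {v = v} t = lookup⇒[]= v _ (Equivalence.to T-≡ t)

∈⇒T : ∀ {n} {D : Subset n} {v} → v ∈ D → T (lookup D v)
∈⇒T v∈D = Equivalence.from T-≡ ([]=⇒lookup v∈D)

-- Graphs and sequences

-- Stated in the full graph, so that sets for `G` and for `delete G u` can be compared on the same
-- vertices.
DominatingBut : ∀ {n} → Graph n → Fin n → Subset n → Set
DominatingBut G u D = ∀ v → v ≢ u → v ∉ D → ∃ λ w → w ∈ D × Graph.Adj G v w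

∣insertAt-outside∣ : ∀ {n} (D : Subset n) u → ∣ insertAt D u outside ∣ ≡ ∣ D ∣
∣insertAt-outside∣ D           zero    = refl
∣insertAt-outside∣ (true ∷ D)  (suc u) = cong suc (∣insertAt-outside∣ D u)
∣insertAt-outside∣ (false ∷ D) (suc u) = ∣insertAt-outside∣ D u

delete⇒but : ∀ {n} (G : Graph n) u {k} → HasDominatingSetOfSize (delete G u) k →
             ∃ λ D → DominatingBut G u D × ∣ D ∣ ≡ k
delete⇒but {suc n} G u (D , dom , size) = insertAt D u outside , but , trans (∣insertAt-outside∣ D u) size
  where
  member : ∀ {v} → v ∈ D → punchIn u v ∈ insertAt D u outside
  member {v} v∈D = T⇒∈ (subst T (sym (insertAt-punchIn D u outside v)) (∈⇒T v∈D))
  back : ∀ {v} → punchIn u v ∉ insertAt D u outside → v ∉ D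
  back v∉ v∈ = v∉ (member v∈)
  but : DominatingBut G u (insertAt D u outside)
  but v v≢u v∉ with dom (punchOut (v≢u ∘ sym))
                        (back (subst (_∉ insertAt D u outside) (sym (punchIn-punchOut (v≢u ∘ sym))) v∉))
  ... | w , w∈D , adj = punchIn u w , member w∈D ,
        subst (λ z → Graph.Adj G z (punchIn u w)) (punchIn-punchOut (v≢u ∘ sym)) adj

-- Since `u` is not in `D`, every neighbour that dominates a vertex survives the deletion.
but⇒delete : ∀ {n} (G : Graph n) u {D} → u ∉ D → DominatingBut G u D →
             HasDominatingSetOfSize (delete G u) ∣ D ∣
but⇒delete {suc n} G u {D} u∉D but = D′ , dom , size
  where
  D′ = removeAt D u
  restore : insertAt D′ u outside ≡ D
  restore = trans (cong (insertAt D′ u) (sym (¬T⇒outside (u∉D ∘ T⇒∈)))) (insertAt-removeAt D u)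
    where
    ¬T⇒outside : ∀ {x} → ¬ T x → x ≡ outside
    ¬T⇒outside {false} _ = refl
    ¬T⇒outside {true} ¬t = ⊥-elim (¬t tt)
  lookup-punchIn : ∀ v → lookup D (punchIn u v) ≡ lookup D′ v
  lookup-punchIn v = trans (cong (λ z → lookup z (punchIn u v)) (sym restore)) (insertAt-punchIn D′ u outside v)
  size : ∣ D′ ∣ ≡ ∣ D ∣
  size = trans (sym (∣insertAt-outside∣ D′ u)) (cong ∣_∣ restore)
  dom : Dominating (delete G u) D′
  dom v v∉ with but (punchIn u v) (punchInᵢ≢i u v)
                    (λ v∈ → v∉ (T⇒∈ (subst T (lookup-punchIn v) (∈⇒T v∈))))
  ... | w , w∈D , adj with u Fin.≟ w
  ...   | yes refl = ⊥-elim (u∉D w∈D)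
  ...   | no u≢w = punchOut u≢w ,
          T⇒∈ (subst T (trans (cong (lookup D) (sym (punchIn-punchOut u≢w))) (lookup-punchIn (punchOut u≢w))) (∈⇒T w∈D)) ,
          subst (Graph.Adj G (punchIn u v)) (sym (punchIn-punchOut u≢w)) adj

γ≡ : ∀ {n k} {G : Graph n} → HasDominatingSetOfSize G k → (∀ {j} → HasDominatingSetOfSize G j → k ≤ j) → γ G ≡ k
γ≡ {G = G} has low = ≤-antisym (proj₂ (γ-isLeast G) has) (low (proj₁ (γ-isLeast G)))

at : ∀ {n} → Vec Bool n → ℕ → Bool
at []       _       = false
at (x ∷ xs) zero    = x
at (x ∷ xs) (suc i) = at xs i

at-toℕ : ∀ {n} (xs : Vec Bool n) i → at xs (toℕ i) ≡ lookup xs i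
at-toℕ (x ∷ xs) zero    = refl
at-toℕ (x ∷ xs) (suc i) = at-toℕ xs i

∣∣-∑ : ∀ {n} (D : Subset n) → ∣ D ∣ ≡ ∣ at D ∣[ n ]
∣∣-∑ []          = refl
∣∣-∑ {suc n} (true ∷ D)  = trans (cong suc (∣∣-∑ D)) (sym (∑-head (bit ∘ at (true ∷ D)) n))
∣∣-∑ {suc n} (false ∷ D) = trans (∣∣-∑ D) (sym (∑-head (bit ∘ at (false ∷ D)) n))

off : Fin 4 → ℕ
off k = 2 ^ toℕ k ∸ 1

-- The neighbours of (2 , 7 + x) lie at 7 + x - `off k`, that is at the offsets 7, 6, 4 and 0 from
-- x.
Covered₁ Covered₂ : Seq → Seq → ℕ → Set
Covered₁ a b x = T (a x) ⊎ ∃ λ k → T (b (off k + x))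
Covered₂ a b x = T (b (7 + x)) ⊎ ∃ λ k → T (a ((7 ∸ off k) + x))

bit-T : ∀ {c} → T c → 1 ≤ bit c
bit-T {true} _ = ≤-refl

T-bit : ∀ {c} → 1 ≤ bit c → T c
T-bit {true} _ = tt

positive-+ : ∀ {x y} → 1 ≤ x + y → 1 ≤ x ⊎ 1 ≤ y
positive-+ {zero}  p = inj₂ p
positive-+ {suc x} p = inj₁ (s≤s z≤n)

inl : ∀ {x} y → 1 ≤ x → 1 ≤ x + y
inl {x} y p = ≤-trans p (m≤m+n x y)

inr : ∀ x {y} → 1 ≤ y → 1 ≤ x + y
inr x {y} p = ≤-trans p (m≤n+m y x)

covered₁⇒pos : ∀ a b x → Covered₁ a b x → 1 ≤ cov₁ a b x
covered₁⇒pos a b x (inj₁ t)         = inl _ (bit-T t)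
covered₁⇒pos a b x (inj₂ (0F , t)) = inr (bit (a x)) (inl _ (bit-T t))
covered₁⇒pos a b x (inj₂ (1F , t)) = inr (bit (a x)) (inr (bit (b x)) (inl _ (bit-T t)))
covered₁⇒pos a b x (inj₂ (2F , t)) = inr (bit (a x)) (inr (bit (b x)) (inr (bit (b (1 + x))) (inl _ (bit-T t))))
covered₁⇒pos a b x (inj₂ (3F , t)) =
  inr (bit (a x)) (inr (bit (b x)) (inr (bit (b (1 + x))) (inr (bit (b (3 + x))) (bit-T t))))

pos⇒covered₁ : ∀ a b x → 1 ≤ cov₁ a b x → Covered₁ a b x
pos⇒covered₁ a b x p with positive-+ {bit (a x)} p
... | inj₁ t = inj₁ (T-bit t)
... | inj₂ p₁ with positive-+ {bit (b x)} p₁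
...   | inj₁ t = inj₂ (0F , T-bit t)
...   | inj₂ p₂ with positive-+ {bit (b (1 + x))} p₂
...     | inj₁ t = inj₂ (1F , T-bit t)
...     | inj₂ p₃ with positive-+ {bit (b (3 + x))} p₃
...       | inj₁ t = inj₂ (2F , T-bit t)
...       | inj₂ t = inj₂ (3F , T-bit t)

covered₂⇒pos : ∀ a b x → Covered₂ a b x → 1 ≤ cov₂ a b x
covered₂⇒pos a b x (inj₂ (3F , t)) = inl _ (bit-T t)
covered₂⇒pos a b x (inj₂ (2F , t)) = inr (bit (a x)) (inl _ (bit-T t))
covered₂⇒pos a b x (inj₂ (1F , t)) = inr (bit (a x)) (inr (bit (a (4 + x))) (inl _ (bit-T t)))
covered₂⇒pos a b x (inj₂ (0F , t)) =
  inr (bit (a x)) (inr (bit (a (4 + x))) (inr (bit (a (6 + x))) (inl _ (bit-T t))))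
covered₂⇒pos a b x (inj₁ t) =
  inr (bit (a x)) (inr (bit (a (4 + x))) (inr (bit (a (6 + x))) (inr (bit (a (7 + x))) (bit-T t))))

pos⇒covered₂ : ∀ a b x → 1 ≤ cov₂ a b x → Covered₂ a b x
pos⇒covered₂ a b x p with positive-+ {bit (a x)} p
... | inj₁ t = inj₂ (3F , T-bit t)
... | inj₂ p₁ with positive-+ {bit (a (4 + x))} p₁
...   | inj₁ t = inj₂ (2F , T-bit t)
...   | inj₂ p₂ with positive-+ {bit (a (6 + x))} p₂
...     | inj₁ t = inj₂ (1F , T-bit t)
...     | inj₂ p₃ with positive-+ {bit (a (7 + x))} p₃
...       | inj₁ t = inj₂ (0F , T-bit t)
...       | inj₂ t = inj₁ (T-bit t)

∑-zero : ∀ {f} n → (∀ x → x < n → f x ≡ 0) → ∑ f n ≡ 0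
∑-zero zero    z = refl
∑-zero (suc n) z = cong₂ _+_ (∑-zero n λ x x<n → z x (m<n⇒m<1+n x<n)) (z n ≤-refl)

∑-single : ∀ {f} x₀ n → (∀ x → f x ≤ 1) → (∀ x → x < n → x ≢ x₀ → f x ≡ 0) → ∑ f n ≤ 1
∑-single x₀ zero    f≤1 z = z≤n
∑-single {f} x₀ (suc n) f≤1 z with n ℕ.≟ x₀
... | yes refl = subst (λ s → s + f n ≤ 1) (sym (∑-zero n λ x x<n → z x (m<n⇒m<1+n x<n) (<⇒≢ x<n))) (f≤1 n)
... | no n≢x₀ = subst (_≤ 1) (sym (trans (cong (∑ f n +_) (z n ≤-refl n≢x₀)) (+-identityʳ _)))
                  (∑-single x₀ n f≤1 λ x x<n → z x (m<n⇒m<1+n x<n))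

-- The Knödel graph in cyclic coordinates

module Knödel (n : ℕ) (7≤m : 7 ≤ n / 2) where
  m : ℕ
  m = n / 2

  instance
    m≢0 : NonZero m
    m≢0 = >-nonZero (≤-trans (s≤s z≤n) 7≤m)

  G : Graph (2 * m)
  G = W 4 n

  open Graph G using (Adj)

  place : Fin 2 → Fin m → Fin (2 * m)
  place = combine

  vertex : Fin 2 → ℕ → Fin (2 * m)
  vertex i x = place i (x mod m)

  toℕ-mod : ∀ x → toℕ (x mod m) ≡ x % m
  toℕ-mod x = toℕ-fromℕ< (m%n<n x m)

  mod-cong : ∀ {x y} → x % m ≡ y % m → x mod m ≡ y mod m
  mod-cong {x} {y} eq = toℕ-injective (trans (toℕ-mod x) (trans eq (sym (toℕ-mod y))))

  mod-toℕ : ∀ (j : Fin m) → toℕ j mod m ≡ j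
  mod-toℕ j = toℕ-injective (trans (toℕ-mod (toℕ j)) (m<n⇒m%n≡m (toℕ<n j)))

  %-+ˡ : ∀ x c → (x % m + c) % m ≡ (x + c) % m
  %-+ˡ x c = begin
    (x % m + c) % m           ≡⟨ %-distribˡ-+ (x % m) c m ⟩
    (x % m % m + c % m) % m   ≡⟨ cong (λ z → (z + c % m) % m) (m%n%n≡m%n x m) ⟩
    (x % m + c % m) % m       ≡⟨ %-distribˡ-+ x c m ⟨
    (x + c) % m               ∎
    where open ≡-Reasoning

  %-cancelʳ : ∀ c {x y} → (x + c) % m ≡ (y + c) % m → x % m ≡ y % m
  %-cancelʳ c {x} {y} eq = trans (sym (undo x)) (trans (cong (λ z → (z + c * pred m) % m) eq) (undo y))
    where
    -- Adding `c` another m - 1 times completes it to `c * m`, which vanishes modulo m; this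
    -- replaces subtracting `c`.
    undo : ∀ x → ((x + c) % m + c * pred m) % m ≡ x % m
    undo x = trans (%-+ˡ (x + c) (c * pred m)) (trans (cong (_% m) (begin
      x + c + c * pred m       ≡⟨ +-assoc x c _ ⟩
      x + (c + c * pred m)     ≡⟨ cong (x +_) (*-suc c (pred m)) ⟨
      x + c * suc (pred m)     ≡⟨ cong (λ z → x + c * z) (suc-pred m) ⟩
      x + c * m                ∎)) ([m+kn]%n≡m%n x c m))
      where open ≡-Reasoning

  %-injective : ∀ {x y} → x < m → y < m → x % m ≡ y % m → x ≡ y
  %-injective x<m y<m eq = trans (sym (m<n⇒m%n≡m x<m)) (trans eq (m<n⇒m%n≡m y<m))

  adj⁺ : ∀ (i i′ : Fin 2) (j j′ : Fin m) → KnödelAdj 4 {m} (i , j) (i′ , j′) → Adj (place i j) (place i′ j′)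
  adj⁺ i i′ j j′ = subst₂ (KnödelAdj 4 {m}) (sym (remQuot-combine {2} {m} i j)) (sym (remQuot-combine {2} {m} i′ j′))

  adj⁻ : ∀ (i i′ : Fin 2) (j j′ : Fin m) → Adj (place i j) (place i′ j′) → KnödelAdj 4 {m} (i , j) (i′ , j′)
  adj⁻ i i′ j j′ = subst₂ (KnödelAdj 4 {m}) (remQuot-combine {2} {m} i j) (remQuot-combine {2} {m} i′ j′)

  edge : ∀ k x → (toℕ (x mod m) + off k) % m ≡ (x + off k) % m
  edge k x = trans (cong (λ z → (z + off k) % m) (toℕ-mod x)) (%-+ˡ x (off k))

  adjacent₁ : ∀ k x → Adj (vertex 0F x) (vertex 1F (off k + x))
  adjacent₁ k x = adj⁺ 0F 1F (x mod m) ((off k + x) mod m)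
    (k , trans (toℕ-mod (off k + x)) (trans (cong (_% m) (+-comm (off k) x)) (sym (edge k x))))

  off≤7 : ∀ k → off k ≤ 7
  off≤7 0F = z≤n
  off≤7 1F = s≤s z≤n
  off≤7 2F = s≤s (s≤s (s≤s z≤n))
  off≤7 3F = ≤-refl

  complement : ∀ k x → (7 ∸ off k) + x + off k ≡ 7 + x
  complement k x = trans (swap (7 ∸ off k) x (off k)) (cong (_+ x) (m∸n+n≡m (off≤7 k)))
    where
    swap : ∀ a x c → a + x + c ≡ a + c + x
    swap = solve-∀

  adjacent₂ : ∀ k x → Adj (vertex 1F (7 + x)) (vertex 0F ((7 ∸ off k) + x))
  adjacent₂ k x = adj⁺ 1F 0F ((7 + x) mod m) (((7 ∸ off k) + x) mod m)
    (k , trans (toℕ-mod (7 + x)) (trans (cong (_% m) (sym (complement k x))) (sym (edge k _))))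

  neighbour₁ : ∀ x w → Adj (vertex 0F x) w → ∃ λ k → w ≡ vertex 1F (off k + x)
  neighbour₁ x w adj with combine-surjective {2} {m} w
  ... | 0F , j , refl = ⊥-elim (adj⁻ 0F 0F (x mod m) j adj)
  ... | 1F , j , refl with adj⁻ 0F 1F (x mod m) j adj
  ...   | k , eq = k , cong (place 1F) (toℕ-injective
            (trans eq (trans (edge k x) (trans (cong (_% m) (+-comm x (off k))) (sym (toℕ-mod (off k + x)))))))

  neighbour₂ : ∀ x w → Adj (vertex 1F (7 + x)) w → ∃ λ k → w ≡ vertex 0F ((7 ∸ off k) + x)
  neighbour₂ x w adj with combine-surjective {2} {m} w
  ... | 1F , j , refl = ⊥-elim (adj⁻ 1F 1F ((7 + x) mod m) j adj)
  ... | 0F , j , refl with adj⁻ 1F 0F ((7 + x) mod m) j adj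
  ...   | k , eq = k , cong (place 0F) (trans (sym (mod-toℕ j)) (mod-cong (%-cancelʳ (off k) (begin
            (toℕ j + off k) % m                 ≡⟨ eq ⟨
            toℕ ((7 + x) mod m)                 ≡⟨ toℕ-mod (7 + x) ⟩
            (7 + x) % m                         ≡⟨ cong (_% m) (complement k x) ⟨
            ((7 ∸ off k) + x + off k) % m       ∎))))
    where open ≡-Reasoning

  -- Side 2 is enumerated from place 7 on, to match the shift in `cov₂`.
  data Position : Fin (2 * m) → Set where
    left  : ∀ x → x < m → Position (vertex 0F x)
    right : ∀ x → x < m → Position (vertex 1F (7 + x))

  position : ∀ v → Position v
  position v with combine-surjective {2} {m} v
  ... | 0F , j , refl = subst (λ z → Position (place 0F z)) (mod-toℕ j) (left (toℕ j) (toℕ<n j))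
  ... | 1F , j , refl = subst (λ z → Position (place 1F z)) (trans (mod-cong eq) (mod-toℕ j))
                          (right x (m%n<n (toℕ j + (m ∸ 7)) m))
    where
    x = (toℕ j + (m ∸ 7)) % m
    eq : (7 + x) % m ≡ toℕ j % m
    eq = begin
      (7 + x) % m                      ≡⟨ cong (_% m) (+-comm 7 x) ⟩
      (x + 7) % m                      ≡⟨ %-+ˡ (toℕ j + (m ∸ 7)) 7 ⟩
      (toℕ j + (m ∸ 7) + 7) % m        ≡⟨ cong (_% m) (trans (+-assoc (toℕ j) (m ∸ 7) 7) (cong (toℕ j +_) (m∸n+n≡m 7≤m))) ⟩
      (toℕ j + m) % m                  ≡⟨ [m+n]%n≡m%n (toℕ j) m ⟩
      toℕ j % m                        ∎
      where open ≡-Reasoning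

  vertex-injective : ∀ i {x y} → vertex i x ≡ vertex i y → x % m ≡ y % m
  vertex-injective i {x} {y} eq = trans (sym (toℕ-mod x)) (trans (cong toℕ same) (toℕ-mod y))
    where
    same : x mod m ≡ y mod m
    same = cong proj₂ (trans (sym (remQuot-combine {2} {m} i (x mod m))) (trans (cong (remQuot {2} m) eq) (remQuot-combine {2} {m} i (y mod m))))

  vertex-side : ∀ {x y} → vertex 0F x ≢ vertex 1F y
  vertex-side {x} {y} eq with trans (sym (remQuot-combine {2} {m} 0F (x mod m)))
    (trans (cong (remQuot {2} m) eq) (remQuot-combine {2} {m} 1F (y mod m)))
  ... | ()

  side : Subset (2 * m) → Fin 2 → Seq
  side D i x = lookup D (vertex i x)

  side-periodic : ∀ D i → Periodic m (side D i)
  side-periodic D i x = cong (λ z → lookup D (place i z)) (mod-cong (trans (cong (_% m) (+-comm m x)) ([m+n]%n≡m%n x m)))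

  side-at : ∀ D i {x} → x < m → side D i x ≡ at D (m * toℕ i + x)
  side-at D i {x} x<m = trans (sym (at-toℕ D (vertex i x))) (cong (at D)
    (trans (toℕ-combine {2} {m} i (x mod m)) (cong (m * toℕ i +_) (trans (toℕ-mod x) (m<n⇒m%n≡m x<m)))))

  size : ∀ D → ∣ side D 0F ∣[ m ] + ∣ side D 1F ∣[ m ] ≡ ∣ D ∣
  size D = sym (begin
    ∣ D ∣                                                ≡⟨ ∣∣-∑ D ⟩
    ∣ at D ∣[ m + (m + 0) ]                              ≡⟨ cong ∣ at D ∣[_] (cong (m +_) (+-identityʳ m)) ⟩
    ∣ at D ∣[ m + m ]                                    ≡⟨ ∑-+ (bit ∘ at D) m m ⟩
    ∣ at D ∣[ m ] + ∣ (λ x → at D (x + m)) ∣[ m ]        ≡⟨ cong₂ _+_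
        (∑-cong m λ x x<m → cong bit (sym (trans (side-at D 0F x<m) (cong (λ z → at D (z + x)) (*-zeroʳ m)))))
        (∑-cong m λ x x<m → cong bit (sym (trans (side-at D 1F x<m)
          (cong (at D) (trans (cong (_+ x) (*-identityʳ m)) (+-comm m x)))))) ⟩
    ∣ side D 0F ∣[ m ] + ∣ side D 1F ∣[ m ]              ∎)
    where open ≡-Reasoning

  dominated⇒covered₁ : ∀ D x → (vertex 0F x ∉ D → ∃ λ w → w ∈ D × Adj (vertex 0F x) w) →
                       Covered₁ (side D 0F) (side D 1F) x
  dominated⇒covered₁ D x dom with T? (side D 0F x)
  ... | yes t = inj₁ t
  ... | no ¬t with dom (¬t ∘ ∈⇒T)
  ...   | w , w∈D , adj with neighbour₁ x w adj
  ...     | k , refl = inj₂ (k , ∈⇒T w∈D)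

  dominated⇒covered₂ : ∀ D x → (vertex 1F (7 + x) ∉ D → ∃ λ w → w ∈ D × Adj (vertex 1F (7 + x)) w) →
                       Covered₂ (side D 0F) (side D 1F) x
  dominated⇒covered₂ D x dom with T? (side D 1F (7 + x))
  ... | yes t = inj₁ t
  ... | no ¬t with dom (¬t ∘ ∈⇒T)
  ...   | w , w∈D , adj with neighbour₂ x w adj
  ...     | k , refl = inj₂ (k , ∈⇒T w∈D)

  defects₁ defects₂ : Subset (2 * m) → ℕ
  defects₁ D = defect (cov₁ (side D 0F) (side D 1F)) m
  defects₂ D = defect (cov₂ (side D 0F) (side D 1F)) m

  arrangement-of : ∀ D → Arrangement m ∣ side D 0F ∣[ m ] ∣ side D 1F ∣[ m ] (defects₁ D) (defects₂ D)
  arrangement-of D = arrangement {a = side D 0F} {b = side D 1F}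
    (side-periodic D 0F) (side-periodic D 1F) refl refl refl refl

  no-defect₁ : ∀ D x → (vertex 0F x ∉ D → ∃ λ w → w ∈ D × Adj (vertex 0F x) w) →
               1 ∸ cov₁ (side D 0F) (side D 1F) x ≡ 0
  no-defect₁ D x dom = m≤n⇒m∸n≡0 (covered₁⇒pos (side D 0F) (side D 1F) x (dominated⇒covered₁ D x dom))

  no-defect₂ : ∀ D x → (vertex 1F (7 + x) ∉ D → ∃ λ w → w ∈ D × Adj (vertex 1F (7 + x)) w) →
               1 ∸ cov₂ (side D 0F) (side D 1F) x ≡ 0
  no-defect₂ D x dom = m≤n⇒m∸n≡0 (covered₂⇒pos (side D 0F) (side D 1F) x (dominated⇒covered₂ D x dom))

  dominating⇒defects : ∀ D → Dominating G D → defects₁ D + defects₂ D ≤ 0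
  dominating⇒defects D dom = ≤-reflexive (cong₂ _+_
    (∑-zero m λ x _ → no-defect₁ D x (dom (vertex 0F x)))
    (∑-zero m λ x _ → no-defect₂ D x (dom (vertex 1F (7 + x)))))

  -- The exempt vertex occupies a single place on a single side, so it affects one term of one of
  -- the two sums.
  dominatingBut⇒defects : ∀ D u → DominatingBut G u D → defects₁ D + defects₂ D ≤ 1
  dominatingBut⇒defects D u but with position u
  ... | left x₀ x₀<m = subst (λ z → defects₁ D + z ≤ 1)
        (sym (∑-zero m λ x _ → no-defect₂ D x (but (vertex 1F (7 + x)) (vertex-side ∘ sym))))
        (subst (_≤ 1) (sym (+-identityʳ (defects₁ D)))
          (∑-single x₀ m (λ x → m∸n≤m 1 (cov₁ (side D 0F) (side D 1F) x)) λ x x<m x≢x₀ →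
            no-defect₁ D x (but (vertex 0F x) (x≢x₀ ∘ %-injective x<m x₀<m ∘ vertex-injective 0F))))
  ... | right x₀ x₀<m = subst (λ z → z + defects₂ D ≤ 1)
        (sym (∑-zero m λ x _ → no-defect₁ D x (but (vertex 0F x) vertex-side)))
        (∑-single x₀ m (λ x → m∸n≤m 1 (cov₂ (side D 0F) (side D 1F) x)) λ x x<m x≢x₀ →
          no-defect₂ D x (but (vertex 1F (7 + x)) (x≢x₀ ∘ %-injective x<m x₀<m ∘ unshift x x₀ ∘ vertex-injective 1F)))
    where
    unshift : ∀ x y → (7 + x) % m ≡ (7 + y) % m → x % m ≡ y % m
    unshift x y eq = %-cancelʳ 7 (trans (cong (_% m) (+-comm x 7)) (trans eq (cong (_% m) (+-comm 7 y))))

  -- The converse of `side`: two periodic sequences are turned into the vertex set that has them as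
  -- its sides.
  module Placed {a b : Seq} (pa : Periodic m a) (pb : Periodic m b) where
    choose : Fin 2 × Fin m → Bool
    choose (0F , j) = a (toℕ j)
    choose (1F , j) = b (toℕ j)

    D : Subset (2 * m)
    D = tabulate (λ v → choose (remQuot m v))

    periodic-% : ∀ {c : Seq} → Periodic m c → ∀ x → c (x % m) ≡ c x
    periodic-% {c} p x = sym (trans (cong c (trans (m≡m%n+[m/n]*n x m) (+-comm (x % m) _))) (periodic-* p (x / m) (x % m)))

    side-0 : ∀ x → side D 0F x ≡ a x
    side-0 x = trans (lookup∘tabulate (λ v → choose (remQuot m v)) (vertex 0F x)) (trans (cong choose (remQuot-combine {2} {m} 0F (x mod m)))
      (trans (cong a (toℕ-mod x)) (periodic-% pa x)))

    side-1 : ∀ x → side D 1F x ≡ b x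
    side-1 x = trans (lookup∘tabulate (λ v → choose (remQuot m v)) (vertex 1F x)) (trans (cong choose (remQuot-combine {2} {m} 1F (x mod m)))
      (trans (cong b (toℕ-mod x)) (periodic-% pb x)))

    ∣D∣ : ∣ D ∣ ≡ ∣ a ∣[ m ] + ∣ b ∣[ m ]
    ∣D∣ = trans (sym (size D)) (cong₂ _+_ (∑-cong m λ x _ → cong bit (side-0 x)) (∑-cong m λ x _ → cong bit (side-1 x)))

    covered₁⇒dominated : ∀ x → 1 ≤ cov₁ a b x → vertex 0F x ∉ D → ∃ λ w → w ∈ D × Adj (vertex 0F x) w
    covered₁⇒dominated x p v∉D with pos⇒covered₁ a b x p
    ... | inj₁ t       = ⊥-elim (v∉D (T⇒∈ (subst T (sym (side-0 x)) t)))
    ... | inj₂ (k , t) = _ , T⇒∈ (subst T (sym (side-1 (off k + x))) t) , adjacent₁ k x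

    covered₂⇒dominated : ∀ x → 1 ≤ cov₂ a b x → vertex 1F (7 + x) ∉ D → ∃ λ w → w ∈ D × Adj (vertex 1F (7 + x)) w
    covered₂⇒dominated x p v∉D with pos⇒covered₂ a b x p
    ... | inj₁ t       = ⊥-elim (v∉D (T⇒∈ (subst T (sym (side-1 (7 + x))) t)))
    ... | inj₂ (k , t) = _ , T⇒∈ (subst T (sym (side-0 ((7 ∸ off k) + x))) t) , adjacent₂ k x

    dominating : (∀ x → 1 ≤ cov₁ a b x) → (∀ x → 1 ≤ cov₂ a b x) → Dominating G D
    dominating c₁ c₂ v v∉D with position v
    ... | left x _  = covered₁⇒dominated x (c₁ x) v∉D
    ... | right x _ = covered₂⇒dominated x (c₂ x) v∉D

    dominatingBut : (∀ x → x < m → x ≢ 0 → 1 ≤ cov₁ a b x) → (∀ x → x < m → 1 ≤ cov₂ a b x) →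
      DominatingBut G (vertex 0F 0) D
    dominatingBut c₁ c₂ v v≢u v∉D with position v
    ... | left x x<m  = covered₁⇒dominated x (c₁ x x<m λ { refl → v≢u refl }) v∉D
    ... | right x x<m = covered₂⇒dominated x (c₂ x x<m) v∉D

-- Dominating sets as cyclic words

-- One letter describes (1 , j) and (2 , j) together; none stands for both, as no word below selects
-- both.
data Cell : Set where
  ○ A B : Cell

inA inB : Cell → Bool
inA A = true
inA _ = false
inB B = true
inB _ = false

cell : List Cell → ℕ → Cell
cell []       _       = ○
cell (c ∷ cs) zero    = c
cell (c ∷ cs) (suc i) = cell cs i

sideA sideB : List Cell → Seq
sideA w = inA ∘ cell w
sideB w = inB ∘ cell w

occupied : List Cell → ℕ
occupied []       = 0
occupied (c ∷ cs) = bit (inA c) + bit (inB c) + occupied cs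

covered₁ covered₂ : List Cell → Bool
covered₁ w = 1 ≤ᵇ cov₁ (sideA w) (sideB w) 0
covered₂ w = 1 ≤ᵇ cov₂ (sideA w) (sideB w) 0

allCovered : List Cell → Bool
allCovered []       = true
-- A suffix with fewer than eight cells contains no full window and is exempt.
allCovered (c ∷ cs) = ((length cs <ᵇ 7) ∨ (covered₁ (c ∷ cs) ∧ covered₂ (c ∷ cs))) ∧ allCovered cs

allCovered-sound : ∀ w → T (allCovered w) → ∀ y → 7 + y < length w →
  1 ≤ cov₁ (sideA w) (sideB w) y × 1 ≤ cov₂ (sideA w) (sideB w) y
allCovered-sound (c ∷ cs) t (suc y) (s≤s lt) =
  allCovered-sound cs (proj₂ (Equivalence.to (T-∧ {(length cs <ᵇ 7) ∨ _}) t)) y lt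
allCovered-sound (c ∷ cs) t zero (s≤s 7≤) =
  ≤ᵇ⇒≤ 1 _ (proj₁ both) , ≤ᵇ⇒≤ 1 _ (proj₂ both)
  where
  first-window : ∀ {x y} → ¬ T x → T (x ∨ y) → T y
  first-window {false} _  t = t
  first-window {true}  ¬t _ = contradiction tt ¬t
  both = Equivalence.to (T-∧ {covered₁ (c ∷ cs)})
    (first-window {length cs <ᵇ 7} (λ lt → <⇒≱ (<ᵇ⇒< (length cs) 7 lt) 7≤)
      (proj₁ (Equivalence.to (T-∧ {(length cs <ᵇ 7) ∨ _}) t)))

cell-++ˡ : ∀ w v {i} → i < length w → cell (w ++ v) i ≡ cell w i
cell-++ˡ (c ∷ w) v {zero}  _        = refl
cell-++ˡ (c ∷ w) v {suc i} (s≤s lt) = cell-++ˡ w v lt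

cell-++ʳ : ∀ w v i → cell (w ++ v) (i + length w) ≡ cell v i
cell-++ʳ []      v i = cong (cell v) (+-identityʳ i)
cell-++ʳ (c ∷ w) v i = trans (cong (cell (c ∷ w ++ v)) (+-suc i (length w))) (cell-++ʳ w v i)

cell-take : ∀ k w {i} → i < k → cell (take k w) i ≡ cell w i
cell-take (suc k) []                _        = refl
cell-take (suc k) (c ∷ w) {zero}  _        = refl
cell-take (suc k) (c ∷ w) {suc i} (s≤s lt) = cell-take k w lt

occupied-∑ : ∀ w → ∣ sideA w ∣[ length w ] + ∣ sideB w ∣[ length w ] ≡ occupied w
occupied-∑ []      = refl
occupied-∑ (c ∷ w) = begin
  ∣ sideA (c ∷ w) ∣[ suc l ] + ∣ sideB (c ∷ w) ∣[ suc l ]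
    ≡⟨ cong₂ _+_ (∑-head (bit ∘ sideA (c ∷ w)) l) (∑-head (bit ∘ sideB (c ∷ w)) l) ⟩
  bit (inA c) + ∣ sideA w ∣[ l ] + (bit (inB c) + ∣ sideB w ∣[ l ])
    ≡⟨ interchange (bit (inA c)) _ (bit (inB c)) _ ⟩
  bit (inA c) + bit (inB c) + (∣ sideA w ∣[ l ] + ∣ sideB w ∣[ l ])
    ≡⟨ cong (bit (inA c) + bit (inB c) +_) (occupied-∑ w) ⟩
  occupied (c ∷ w) ∎
  where
  l = length w
  open ≡-Reasoning

-- Repeating the first seven cells turns every cyclic window of eight cells into an ordinary one.
wrapped : List Cell → List Cell
wrapped w = w ++ take 7 w

-- The vertex (1 , 0) is exempt.
coveredBut₀ : List Cell → Bool
coveredBut₀ []         = false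
coveredBut₀ (c ∷ cs) = covered₂ (c ∷ cs) ∧ allCovered cs

record Word (m k : ℕ) (good : List Cell → Bool) : Set where
  constructor word
  field
    cells   : List Cell
    len     : length cells ≡ m
    weighs  : occupied cells ≡ k
    covers  : T (good (wrapped cells))

cov-cong : ∀ a a′ b b′ x → (∀ {i} → i ≤ 7 → a (i + x) ≡ a′ (i + x)) → (∀ {i} → i ≤ 7 → b (i + x) ≡ b′ (i + x)) →
  cov₁ a b x ≡ cov₁ a′ b′ x × cov₂ a b x ≡ cov₂ a′ b′ x
cov-cong a a′ b b′ x p q =
  cong₂ _+_ (cong bit (p {0} z≤n)) (cong₂ _+_ (cong bit (q {0} z≤n)) (cong₂ _+_ (cong bit (q {1} (m≤m+n 1 6)))
    (cong₂ _+_ (cong bit (q {3} (m≤m+n 3 4))) (cong bit (q {7} ≤-refl))))) ,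
  cong₂ _+_ (cong bit (p {0} z≤n)) (cong₂ _+_ (cong bit (p {4} (m≤m+n 4 3))) (cong₂ _+_ (cong bit (p {6} (m≤m+n 6 1)))
    (cong₂ _+_ (cong bit (p {7} ≤-refl)) (cong bit (q {7} ≤-refl)))))

-- Stability and instability from words

module Stability (n : ℕ) (7≤m : 7 ≤ n / 2) where
  open Knödel n 7≤m

  module Cyclic {k : ℕ} {good : List Cell → Bool} (w : Word m k good) where
    open Word w

    a b : Seq
    a x = sideA cells (x % m)
    b x = sideB cells (x % m)

    per : ∀ {C : Set} {f : ℕ → C} → Periodic m (λ x → f (x % m))
    per {f = f} x = cong f (trans (cong (_% m) (+-comm m x)) ([m+n]%n≡m%n x m))

    total : ∣ a ∣[ m ] + ∣ b ∣[ m ] ≡ k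
    total = trans (cong₂ _+_ (∑-cong m λ x x<m → cong (bit ∘ sideA cells) (m<n⇒m%n≡m x<m))
                              (∑-cong m λ x x<m → cong (bit ∘ sideB cells) (m<n⇒m%n≡m x<m)))
             (trans (cong (λ z → ∣ sideA cells ∣[ z ] + ∣ sideB cells ∣[ z ]) (sym len)) (trans (occupied-∑ cells) weighs))

    length-wrapped : length (wrapped cells) ≡ m + 7
    length-wrapped = trans (length-++ cells) (cong₂ _+_ len (trans (length-take 7 cells) (m≤n⇒m⊓n≡m (subst (7 ≤_) (sym len) 7≤m))))

    unwrap : ∀ {z} → z < m + 7 → cell (wrapped cells) z ≡ cell cells (z % m)
    unwrap {z} lt with z <? m
    ... | yes z<m = trans (cell-++ˡ cells _ (subst (z <_) (sym len) z<m)) (cong (cell cells) (sym (m<n⇒m%n≡m z<m)))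
    ... | no  z≮m = begin
      cell (wrapped cells) z                       ≡⟨ cong (cell (wrapped cells)) z≡ ⟨
      cell (wrapped cells) (y + length cells)      ≡⟨ cell-++ʳ cells (take 7 cells) y ⟩
      cell (take 7 cells) y                        ≡⟨ cell-take 7 cells y<7 ⟩
      cell cells y                                 ≡⟨ cong (cell cells) (m<n⇒m%n≡m (≤-trans y<7 7≤m)) ⟨
      cell cells (y % m)                           ≡⟨ cong (cell cells) ([m+n]%n≡m%n y m) ⟨
      cell cells ((y + m) % m)                     ≡⟨ cong (λ t → cell cells (t % m)) (m∸n+n≡m (≮⇒≥ z≮m)) ⟩
      cell cells (z % m)                           ∎
      where
      open ≡-Reasoning
      y = z ∸ m
      z≡ : y + length cells ≡ z
      z≡ = trans (cong (y +_) len) (m∸n+n≡m (≮⇒≥ z≮m))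
      y<7 : y < 7
      y<7 = +-cancelʳ-< m y 7 (subst₂ _<_ (sym (m∸n+n≡m (≮⇒≥ z≮m))) (+-comm m 7) lt)

    agrees : ∀ {x} → x < m →
      cov₁ a b x ≡ cov₁ (sideA (wrapped cells)) (sideB (wrapped cells)) x ×
      cov₂ a b x ≡ cov₂ (sideA (wrapped cells)) (sideB (wrapped cells)) x
    agrees {x} x<m = cov-cong a (sideA (wrapped cells)) b (sideB (wrapped cells)) x (λ i≤7 → cong inA (sym (unwrap (inside-range i≤7)))) (λ i≤7 → cong inB (sym (unwrap (inside-range i≤7))))
      where
      inside-range : ∀ {i} → i ≤ 7 → i + x < m + 7
      inside-range {i} i≤7 = subst (i + x <_) (+-comm 7 m) (+-mono-≤-< i≤7 x<m)

  -- The word bounds γ from above for `G` and, rotated so that an empty place falls on `u`, for the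
  -- deleted graph. One lower bound serves both, as a dominating set is in particular dominating
  -- except at `u`.
  stable : ∀ {k} (w : Word m k allCovered) → cell (Word.cells w) 1 ≡ ○ → LowerBound 1 m k → γ-Stable G
  stable {k} w empty₁ lower u = trans
    (γ≡ {G = delete G u} (avoiding u) λ has → lower-but (delete⇒but G u has))
    (sym (γ≡ {G = G} whole λ { (D , dom , sz) → lower-but {u} (D , (λ v _ → dom v) , sz) }))
    where
    open Cyclic w
    covers-all : ∀ x → x < m → 1 ≤ cov₁ a b x × 1 ≤ cov₂ a b x
    covers-all x x<m with agrees x<m
                        | allCovered-sound (wrapped (Word.cells w)) (Word.covers w) x
                            (subst (7 + x <_) (trans (+-comm 7 m) (sym length-wrapped)) (+-monoʳ-< 7 x<m))
    ... | e₁ , e₂ | p₁ , p₂ = subst (1 ≤_) (sym e₁) p₁ , subst (1 ≤_) (sym e₂) p₂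

    reduce : ∀ {f} → Periodic m f → (∀ x → x < m → 1 ≤ f x) → ∀ x → 1 ≤ f x
    reduce {f} p pos x = subst (1 ≤_) (sym (trans (cong f (trans (m≡m%n+[m/n]*n x m) (+-comm (x % m) _)))
      (periodic-* p (x / m) (x % m)))) (pos (x % m) (m%n<n x m))

    pos₁ : ∀ x → 1 ≤ cov₁ a b x
    pos₁ = reduce (cov₁-periodic (per {f = sideA (Word.cells w)}) (per {f = sideB (Word.cells w)})) λ x lt → proj₁ (covers-all x lt)
    pos₂ : ∀ x → 1 ≤ cov₂ a b x
    pos₂ = reduce (cov₂-periodic (per {f = sideA (Word.cells w)}) (per {f = sideB (Word.cells w)})) λ x lt → proj₂ (covers-all x lt)

    module Shifted (t : ℕ) where
      paᵗ : Periodic m (λ x → a (x + t))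
      paᵗ = periodic-shift (per {f = sideA (Word.cells w)}) t
      pbᵗ : Periodic m (λ x → b (x + t))
      pbᵗ = periodic-shift (per {f = sideB (Word.cells w)}) t
      open Placed paᵗ pbᵗ public
      dom : Dominating G D
      dom = dominating (λ x → pos₁ (x + t)) (λ x → pos₂ (x + t))
      sz : ∣ D ∣ ≡ k
      sz = trans ∣D∣ (trans (cong₂ _+_ (∑-shift (cong bit ∘ per {f = sideA (Word.cells w)}) t)
                                       (∑-shift (cong bit ∘ per {f = sideB (Word.cells w)}) t)) total)

    whole : HasDominatingSetOfSize G k
    whole = Shifted.D 0 , Shifted.dom 0 , Shifted.sz 0

    -- Rotation by 2m + 1 - y carries place y to the empty place 1. The two full turns keep the
    -- subtraction exact up to y = 2m, which includes the places 7 + x of side 2.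
    shifted-empty : ∀ {f : Cell → Bool} → f ○ ≡ false → ∀ y → y ≤ m + m → f (cell (Word.cells w) ((y + (suc (m + m) ∸ y)) % m)) ≡ false
    shifted-empty {f} f○ y y≤ = trans (cong f (trans (cong (cell (Word.cells w)) (trans (cong (_% m) (m+[n∸m]≡n (m≤n⇒m≤1+n y≤)))
      (trans (cong (_% m) (cong suc (sym (cong (m +_) (+-identityʳ m))))) (trans ([m+kn]%n≡m%n 1 2 m) (m<n⇒m%n≡m (≤-trans (m≤m+n 2 5) 7≤m))))) ) empty₁)) f○

    avoiding : ∀ u → HasDominatingSetOfSize (delete G u) k
    avoiding u with position u
    ... | left x x<m = subst (HasDominatingSetOfSize (delete G (vertex 0F x))) sz
          (but⇒delete G (vertex 0F x) (λ u∈D → subst T (trans (side-0 x) (shifted-empty {inA} refl x (≤-trans (<⇒≤ x<m) (m≤m+n m m)))) (∈⇒T u∈D))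
            (λ v _ → dom v))
      where open Shifted (suc (m + m) ∸ x)
    ... | right x x<m = subst (HasDominatingSetOfSize (delete G (vertex 1F (7 + x)))) sz
          (but⇒delete G (vertex 1F (7 + x)) (λ u∈D → subst T (trans (side-1 (7 + x)) (shifted-empty {inB} refl (7 + x) (+-mono-≤ 7≤m (<⇒≤ x<m)))) (∈⇒T u∈D))
            (λ v _ → dom v))
      where open Shifted (suc (m + m) ∸ (7 + x))

    lower-but : ∀ {u j} → (∃ λ D → DominatingBut G u D × ∣ D ∣ ≡ j) → k ≤ j
    lower-but {u} (D , but , refl) = subst (k ≤_) (size D) (lower (dominatingBut⇒defects D u but) (arrangement-of D))

  -- The word avoids (1 , 0) and dominates all other vertices, so deleting this vertex brings γ down
  -- to at most k, while the lower bound gives γ > k for `G`.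
  unstable : ∀ {k} (w : Word m k coveredBut₀) → cell (Word.cells w) 0 ≡ ○ → LowerBound 0 m (suc k) → ¬ γ-Stable G
  unstable {k} w empty₀ lower st = <⇒≱ large (subst (_≤ k) (st u) small)
    where
    open Cyclic w
    open Placed (per {f = sideA (Word.cells w)}) (per {f = sideB (Word.cells w)})
    u = vertex 0F 0
    split : ∀ v → T (coveredBut₀ v) → ∀ x → 7 + x < length v →
      (x ≢ 0 → 1 ≤ cov₁ (sideA v) (sideB v) x) × 1 ≤ cov₂ (sideA v) (sideB v) x
    split (c ∷ cs) t zero    lt       = (λ 0≢0 → contradiction refl 0≢0) , ≤ᵇ⇒≤ 1 _ (proj₁ (Equivalence.to (T-∧ {covered₂ (c ∷ cs)}) t))
    split (c ∷ cs) t (suc x) (s≤s lt) with allCovered-sound cs (proj₂ (Equivalence.to (T-∧ {covered₂ (c ∷ cs)}) t)) x lt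
    ... | p₁ , p₂ = (λ _ → p₁) , p₂
    covers-but : ∀ x → x < m → (x ≢ 0 → 1 ≤ cov₁ a b x) × 1 ≤ cov₂ a b x
    covers-but x x<m with agrees x<m
                        | split (wrapped (Word.cells w)) (Word.covers w) x
                            (subst (7 + x <_) (trans (+-comm 7 m) (sym length-wrapped)) (+-monoʳ-< 7 x<m))
    ... | e₁ , e₂ | p₁ , p₂ = (λ x≢0 → subst (1 ≤_) (sym e₁) (p₁ x≢0)) , subst (1 ≤_) (sym e₂) p₂
    u∉D : vertex 0F 0 ∉ D
    u∉D u∈D = subst T (trans (side-0 0) (cong inA (trans (cong (cell (Word.cells w)) (m<n⇒m%n≡m (≤-trans (s≤s z≤n) 7≤m))) empty₀))) (∈⇒T u∈D)
    small : γ (delete G u) ≤ k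
    small = proj₂ (γ-isLeast (delete G u)) (subst (HasDominatingSetOfSize (delete G u)) (trans ∣D∣ total)
      (but⇒delete G u u∉D (dominatingBut (λ x x<m → proj₁ (covers-but x x<m)) (λ x x<m → proj₂ (covers-but x x<m)))))
    large : k < γ G
    large with proj₁ (γ-isLeast G)
    ... | D′ , dom , sz = subst (k <_) (trans (size D′) sz) (lower (dominating⇒defects D′ dom) (arrangement-of D′))

-- The explicit words

blocks : ℕ → List Cell
blocks zero    = []
-- Two members have ten incidences with closed neighbourhoods, as many as a block has vertices:
-- repeated cyclically, the pattern dominates every vertex exactly once.
blocks (suc q) = ○ ∷ ○ ∷ B ∷ A ∷ ○ ∷ blocks q

-- The windows that start in the first block end in the third one at the latest.
allCovered-blocks : ∀ q {v} → T (allCovered (blocks 2 ++ v)) → T (allCovered (blocks (2 + q) ++ v))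
allCovered-blocks zero    t = t
allCovered-blocks (suc q) t = allCovered-blocks q t

length-blocks : ∀ q → length (blocks q) ≡ q * 5
length-blocks zero    = refl
length-blocks (suc q) = cong (5 +_) (length-blocks q)

occupied-blocks : ∀ q → occupied (blocks q) ≡ q * 2
occupied-blocks zero    = refl
occupied-blocks (suc q) = cong (2 +_) (occupied-blocks q)

-- Found by computer search.
head₀ head₁ head₂ head₃ head₄ word₈ word₉ word₁₃ word₁₄ word₁₈ : List Cell
head₀  = ○ ∷ ○ ∷ B ∷ A ∷ ○ ∷ ○ ∷ ○ ∷ B ∷ A ∷ ○ ∷ []
head₁  = ○ ∷ ○ ∷ B ∷ A ∷ A ∷ ○ ∷ ○ ∷ ○ ∷ B ∷ A ∷ ○ ∷ []
head₂  = ○ ∷ ○ ∷ B ∷ A ∷ ○ ∷ ○ ∷ ○ ∷ B ∷ B ∷ A ∷ A ∷ ○ ∷ []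
head₃  = ○ ∷ ○ ∷ B ∷ A ∷ ○ ∷ ○ ∷ ○ ∷ B ∷ A ∷ ○ ∷ A ∷ A ∷ B ∷ []
head₄  = ○ ∷ ○ ∷ B ∷ A ∷ ○ ∷ ○ ∷ A ∷ A ∷ B ∷ []
word₈  = ○ ∷ ○ ∷ ○ ∷ B ∷ B ∷ ○ ∷ A ∷ A ∷ []
word₉  = ○ ∷ ○ ∷ ○ ∷ B ∷ B ∷ ○ ∷ ○ ∷ A ∷ A ∷ []
word₁₃ = ○ ∷ ○ ∷ A ∷ ○ ∷ B ∷ ○ ∷ A ∷ A ∷ ○ ∷ ○ ∷ ○ ∷ B ∷ B ∷ []
word₁₄ = ○ ∷ ○ ∷ ○ ∷ ○ ∷ B ∷ ○ ∷ ○ ∷ B ∷ B ∷ B ∷ A ∷ ○ ∷ A ∷ A ∷ []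
word₁₈ = word₉ ++ word₉

W₀ : ∀ q → Word ((2 + q) * 5) ((2 + q) * 2) allCovered
W₀ q = word (head₀ ++ blocks q) (cong (10 +_) (length-blocks q)) (cong (4 +_) (occupied-blocks q)) (ok q)
  where
  ok : ∀ q → T (allCovered (wrapped (head₀ ++ blocks q)))
  -- With fewer than two blocks, windows starting in the head reach the repeated cells, so these
  -- words are evaluated outright.
  ok 0             = tt
  ok 1             = tt
  ok (suc (suc q)) = allCovered-blocks q tt

W₁ : ∀ q → Word (1 + (2 + q) * 5) (1 + (2 + q) * 2) coveredBut₀
W₁ q = word (head₁ ++ blocks q) (cong (11 +_) (length-blocks q)) (cong (5 +_) (occupied-blocks q)) (ok q)
  where
  ok : ∀ q → T (coveredBut₀ (wrapped (head₁ ++ blocks q)))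
  ok 0             = tt
  ok 1             = tt
  ok (suc (suc q)) = allCovered-blocks q tt

W₂ : ∀ q → Word (2 + (2 + q) * 5) (2 + (2 + q) * 2) allCovered
W₂ q = word (head₂ ++ blocks q) (cong (12 +_) (length-blocks q)) (cong (6 +_) (occupied-blocks q)) (ok q)
  where
  ok : ∀ q → T (allCovered (wrapped (head₂ ++ blocks q)))
  ok 0             = tt
  ok 1             = tt
  ok (suc (suc q)) = allCovered-blocks q tt

W₃ : ∀ q → Word (3 + (4 + q) * 5) (3 + (4 + q) * 2) allCovered
W₃ q = word (head₃ ++ blocks (2 + q)) (cong (23 +_) (length-blocks q)) (cong (11 +_) (occupied-blocks q)) (allCovered-blocks q tt)

W₄ : ∀ q → Word (4 + (3 + q) * 5) (3 + (3 + q) * 2) coveredBut₀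
W₄ q = word (head₄ ++ blocks (2 + q)) (cong (19 +_) (length-blocks q)) (cong (9 +_) (occupied-blocks q)) (allCovered-blocks q tt)

-- The case distinction modulo 5

Criterion : ℕ → Set
Criterion n = (n ≡ 18 ⊎ n ≡ 28) ⊎ (n % 10 ≡ 0 ⊎ n % 10 ≡ 4) ⊎ (n ≢ 26 × n % 10 ≡ 6)

module Cases (n : ℕ) (8≤m : 8 ≤ n / 2) where
  7≤m : 7 ≤ n / 2
  7≤m = ≤-trans (n≤1+n 7) 8≤m
  open Stability n 7≤m

  -- Here `m` is a variable, so the equation can be matched; `n / 2` and `r + q * 5` would not
  -- unify.
  stable-at : ∀ {m k} → n / 2 ≡ m → (w : Word m k allCovered) → cell (Word.cells w) 1 ≡ ○ → LowerBound 1 m k → γ-Stable (W 4 n)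
  stable-at refl = stable

  unstable-at : ∀ {m k} → n / 2 ≡ m → (w : Word m k coveredBut₀) → cell (Word.cells w) 0 ≡ ○ → LowerBound 0 m (suc k) → ¬ γ-Stable (W 4 n)
  unstable-at refl = unstable

quotient-> : ∀ k {r q} → r + k * 5 < 8 → 8 ≤ r + q * 5 → k < q
quotient-> k {r} small large = ≰⇒> λ q≤k → <⇒≱ small (≤-trans large (residue-mono r q≤k))

theorem4p6 : (n : ℕ) → 16 ≤ n → 2 ∣ n →
    γ-Stable (W 4 n) ⇔
    ((n ≡ 18 ⊎ n ≡ 28)
    ⊎ (n % 10 ≡ 0 ⊎ n % 10 ≡ 4)
    ⊎ (n ≢ 26 × n % 10 ≡ 6))
-- For n = 2m the residue of m modulo 5 determines that of n modulo 10. Residues 0 and 2 of m are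
-- always stable and 1 never; 3 is stable except for m = 13, and 4 is unstable except for m = 9 and
-- 14.
theorem4p6 n 16≤n 2∣n = by-residue ((n / 2) divMod 5)
  where
  8≤m : 8 ≤ n / 2
  8≤m = /-monoˡ-≤ 2 16≤n
  open Cases n 8≤m

  twice : ∀ {r q} → n / 2 ≡ r + q * 5 → n ≡ r * 2 + q * 10
  twice {r} {q} e = trans (sym (m/n*n≡m 2∣n)) (trans (cong (_* 2) e) (distr r q))
    where
    distr : ∀ r q → (r + q * 5) * 2 ≡ r * 2 + q * 10
    distr = solve-∀

  residue : ∀ {r q} → r * 2 < 10 → n / 2 ≡ r + q * 5 → n % 10 ≡ r * 2
  residue {r} {q} r<10 e = trans (cong (_% 10) (twice {r} {q} e)) (trans ([m+kn]%n≡m%n (r * 2) q 10) (m<n⇒m%n≡m r<10))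

  both-hold : ∀ {P Q : Set} → P → Q → P ⇔ Q
  both-hold p q = mk⇔ (λ _ → q) (λ _ → p)

  both-fail : ∀ {P Q : Set} → ¬ P → ¬ Q → P ⇔ Q
  both-fail ¬p ¬q = mk⇔ (⊥-elim ∘ ¬p) (⊥-elim ∘ ¬q)

  not-by-residue : ∀ {s} → n % 10 ≡ s → n ≢ 18 → n ≢ 28 → s ≢ 0 → s ≢ 4 → (n ≢ 26 → s ≢ 6) → ¬ Criterion n
  not-by-residue refl n≢18 n≢28 s≢0 s≢4 s≢6 = λ where
    (inj₁ (inj₁ e))          → n≢18 e
    (inj₁ (inj₂ e))          → n≢28 e
    (inj₂ (inj₁ (inj₁ e)))   → s≢0 e
    (inj₂ (inj₁ (inj₂ e)))   → s≢4 e
    (inj₂ (inj₂ (n≢26 , e))) → s≢6 n≢26 e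

  Goal : Set
  Goal = γ-Stable (W 4 n) ⇔ Criterion n

  case₀ : ∀ q → n / 2 ≡ q * 5 → 2 ≤ q → Goal
  case₀ (suc (suc q)) e _ = both-hold (stable-at e (W₀ q) refl (lower₀ {suc q}))
    (inj₂ (inj₁ (inj₁ (residue {0} {2 + q} (s≤s z≤n) e))))
  case₀ (suc zero) _ (s≤s ())

  case₁ : ∀ q → n / 2 ≡ 1 + q * 5 → 2 ≤ q → Goal
  case₁ (suc (suc q)) e 2≤q = both-fail (unstable-at e (W₁ q) refl (lower₁ 2≤q))
    (not-by-residue r (λ e′ → contradiction (trans (sym r) (cong (_% 10) e′)) λ ())
      (λ e′ → contradiction (trans (sym r) (cong (_% 10) e′)) λ ()) (λ ()) (λ ()) (λ _ ()))
    where
    r : n % 10 ≡ 2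
    r = residue {1} {2 + q} (m≤m+n 3 7) e
  case₁ (suc zero) _ (s≤s ())

  case₂ : ∀ q → n / 2 ≡ 2 + q * 5 → 2 ≤ q → Goal
  case₂ (suc (suc q)) e 2≤q = both-hold (stable-at e (W₂ q) refl (lower₂ 2≤q))
    (inj₂ (inj₁ (inj₂ (residue {2} {2 + q} (m≤m+n 5 5) e))))
  case₂ (suc zero) _ (s≤s ())

  case₃ : ∀ q → n / 2 ≡ 3 + q * 5 → 1 ≤ q → Goal
  case₃ q e 1≤q = go q e 1≤q (residue {3} {q} (m≤m+n 7 3) e) (twice {3} {q} e)
    where
    go : ∀ q → n / 2 ≡ 3 + q * 5 → 1 ≤ q → n % 10 ≡ 6 → n ≡ 6 + q * 10 → Goal
    go 1 e _ r n≡ = both-hold (stable-at e (word word₈ refl refl tt) refl (lower₃₄ {1} ≤-refl))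
      (inj₂ (inj₂ ((λ n≡26 → contradiction (trans (sym n≡) n≡26) λ ()) , r)))
    -- For m = 13, six vertices dominate all but (1 , 0), whereas a dominating set needs seven.
    go 2 e _ r n≡ = both-fail (unstable-at e (word word₁₃ refl refl tt) refl lower₁₃)
      (not-by-residue r (λ e′ → contradiction (trans (sym n≡) e′) λ ()) (λ e′ → contradiction (trans (sym n≡) e′) λ ())
        (λ ()) (λ ()) (λ n≢26 _ → n≢26 n≡))
    -- For m = 18 the word has eight members, one below the bound for larger m, so the weaker bound
    -- from counting is the sharp one.
    go 3 e _ r n≡ = both-hold (stable-at e (word word₁₈ refl refl tt) refl (lower₃₄ {3} ≤-refl))
      (inj₂ (inj₂ ((λ n≡26 → contradiction (trans (sym n≡) n≡26) λ ()) , r)))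
    go (suc (suc (suc (suc q)))) e _ r n≡ = both-hold (stable-at e (W₃ q) refl (lower₃-generic (m≤m+n 4 q)))
      (inj₂ (inj₂ ((λ n≡26 → contradiction (trans (sym n≡) n≡26) λ ()) , r)))

  case₄ : ∀ q → n / 2 ≡ 4 + q * 5 → 1 ≤ q → Goal
  case₄ q e 1≤q = go q e 1≤q (residue {4} {q} (m≤m+n 9 1) e) (twice {4} {q} e)
    where
    go : ∀ q → n / 2 ≡ 4 + q * 5 → 1 ≤ q → n % 10 ≡ 8 → n ≡ 8 + q * 10 → Goal
    go 1 e _ r n≡ = both-hold (stable-at e (word word₉ refl refl tt) refl (lower₃₄ {1} (n≤1+n 3)))
      (inj₁ (inj₁ n≡))
    -- For m = 14 seven vertices dominate the whole graph, so the bound of `lower₄` does not extend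
    -- to this case and `lower₄-but` is sharp for `G` too.
    go 2 e _ r n≡ = both-hold (stable-at e (word word₁₄ refl refl tt) refl (lower₄-but ≤-refl))
      (inj₁ (inj₂ n≡))
    go (suc (suc (suc q))) e _ r n≡ = both-fail (unstable-at e (W₄ q) refl (lower₄ (m≤m+n 3 q)))
      (not-by-residue r (λ e′ → contradiction (trans (sym n≡) e′) λ ()) (λ e′ → contradiction (trans (sym n≡) e′) λ ())
        (λ ()) (λ ()) (λ _ ()))

  by-residue : DivMod (n / 2) 5 → Goal
  by-residue (result q 0F e) = case₀ q e (quotient-> 1 (m≤m+n 6 2) (subst (8 ≤_) e 8≤m))
  by-residue (result q 1F e) = case₁ q e (quotient-> 1 (m≤m+n 7 1) (subst (8 ≤_) e 8≤m))
  by-residue (result q 2F e) = case₂ q e (quotient-> 1 ≤-refl (subst (8 ≤_) e 8≤m))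
  by-residue (result q 3F e) = case₃ q e (quotient-> 0 (m≤m+n 4 4) (subst (8 ≤_) e 8≤m))
  by-residue (result q 4F e) = case₄ q e (quotient-> 0 (m≤m+n 5 3) (subst (8 ≤_) e 8≤m))
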